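{- $E_1$ is in the spectrum of $\mathcal{I}(\mathcal{E}_\infty)$. More precisely, there exists a Borel equivalence relation $F$ on $\mathcal{E}_\infty$ such that for every $m\in\mathbb{N}$ and every $B\in\mathcal{E}_\infty$ the restriction $F\upharpoonright [m,B]_\infty$ is Borel bireducible with $E_1$.
   Context: $\mathcal{E}_\infty$ is the set of all equivalence relations on $\mathbb{N}=\{0,1,2,\ldots\}$ with infinitely many classes. For $A,B\in\mathcal{E}_\infty$ write $A\le B$ if every $A$-class is a union of $B$-classes. $\mathcal{E}_\infty$ carries the Polish topology inherited from $2^{\mathbb{N}\times\mathbb{N}}$ (viewing an equivalence relation as a subset of $\mathbb{N}\times\mathbb{N}$; equivalently, generated by the sets $\{A: A\upharpoonright k = s\}$ with $k=\min$ of some $A$-class), and "Borel" refers to this topology. For $m\in\mathbb{N}$ and $B\in\mathcal{E}_\infty$, $[m,B]_\infty$ is the set of all $A\in\mathcal{E}_\infty$ with $A\le B$ such that $A$ and $B$ have the same restriction to $\{0,\ldots,m-1\}$. $\mathcal{I}(\mathcal{E}_\infty)$ is the $\sigma$-ideal of all $\mathcal{X}\subseteq\mathcal{E}_\infty$ such that for every $B\in\mathcal{E}_\infty$ and $m\in\mathbb{N}$ there is $B'\in[m,B]_\infty$ with $[m,B']_\infty\cap\mathcal{X}=\emptyset$. $E_1$ is the equivalence relation on $2^{\mathbb{N}\times\mathbb{N}}$ given by $x\,E_1\,y$ iff there is $n_0\in\mathbb{N}$ such that $x(n_0+n,m)=y(n_0+n,m)$ for all $n,m\in\mathbb{N}$.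 For equivalence relations $E$ on $X$ and $F$ on $Y$ ($X,Y$ standard Borel), $E\le_B F$ means there is a Borel map $f:X\to Y$ with $x\,E\,x'\iff f(x)\,F\,f(x')$ for all $x,x'\in X$; $E$ and $F$ are Borel bireducible if $E\le_B F$ and $F\le_B E$. An analytic equivalence relation $F$ on a Polish space $X$ is in the spectrum of a $\sigma$-ideal $\mathcal{I}$ on $X$ if for every Borel $\mathcal{B}\subseteq X$ with $\mathcal{B}\notin\mathcal{I}$ there is a Borel $\mathcal{C}\subseteq\mathcal{B}$ with $\mathcal{C}\notin\mathcal{I}$ such that $F$ and $F\upharpoonright\mathcal{C}$ are Borel bireducible. Saying that $E_1$ (which lives on $2^{\mathbb{N}\times\mathbb{N}}$) is in the spectrum of $\mathcal{I}(\mathcal{E}_\infty)$ means that some equivalence relation on $\mathcal{E}_\infty$ that is Borel bireducible with $E_1$ is in the spectrum of $\mathcal{I}(\mathcal{E}_\infty)$. -}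

module Defs where

open import Level using (0ℓ)
open import Data.Bool.Base using (Bool; T; true)
open import Data.Nat.Base using (ℕ; _+_; _<_) renaming (_≤_ to _≤ℕ_)
open import Data.Nat.Properties using (<-≤-trans)
open import Data.Product.Base using (_×_; _,_; proj₁; map; uncurry; ∃; ∃-syntax; Σ-syntax)
open import Data.Product.Relation.Binary.Pointwise.NonDependent using (Pointwise; ×-isEquivalence)
open import Function.Base using (_on_; _∘_)
open import Function.Bundles using (_⇔_)
open import Function.Definitions using (Injective)
open import Relation.Binary.Core using (Rel)
open import Relation.Binary.Structures using (IsEquivalence)
open import Relation.Binary.PropositionalEquality using (_≡_; refl; sym; trans)
import Relation.Binary.Construct.On as On
open import Relation.Nullary.Negation using (¬_)
open import Relation.Unary using (Pred; _∈_; _⊆_; _≐_; _∩_; ∁; ⋃; Empty)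

-- A topology presented by a countable base of entourages, as in a metric
-- space: the sets { y | Near k x y } (k ∈ ℕ) are a neighbourhood base at x.
-- Points that are Near k for every k are topologically indistinguishable;
-- they play the role of equal points (no function extensionality is assumed).
record Space : Set₁ where
  field
    Carrier       : Set
    Near          : ℕ → Rel Carrier 0ℓ
    isEquivalence : ∀ k → IsEquivalence (Near k)
    antitone      : ∀ {k l x y} → k ≤ℕ l → Near l x y → Near k x y

open Space public using (Carrier; Near)

Subset : Space → Set₁
Subset X = Pred (Carrier X) 0ℓ

module _ (X : Space) where

  Open : Pred (Subset X) 0ℓ
  Open U = ∀ x → x ∈ U → ∃[ k ] (∀ y → Near X k x y → y ∈ U)

  -- The σ-algebra generated by the open sets. The constructor resp is there
  -- because subsets are Set-valued and sets with the same elements need not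
  -- be definitionally equal.
  data Borel : Subset X → Set₁ where
    open-set   : ∀ {U} → Open U → Borel U
    complement : ∀ {U} → Borel U → Borel (∁ U)
    union      : ∀ {U : ℕ → Subset X} → (∀ n → Borel (U n)) → Borel (⋃ ℕ U)
    resp       : ∀ {U V} → U ≐ V → Borel U → Borel V

BorelMap : (X Y : Space) → (Carrier X → Carrier Y) → Set₁
BorelMap X Y f = ∀ {U : Subset Y} → Borel Y U → Borel X (U ∘ f)

infixr 2 _⊗_

_⊗_ : Space → Space → Space
X ⊗ Y = record
  { Carrier       = Carrier X × Carrier Y
  ; Near          = λ k → Pointwise (Near X k) (Near Y k)
  ; isEquivalence = λ k → ×-isEquivalence (Space.isEquivalence X k) (Space.isEquivalence Y k)
  ; antitone      = λ k≤l → map (Space.antitone X k≤l) (Space.antitone Y k≤l)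
  }

initial : (X : Space) {A : Set} → (A → Carrier X) → Space
initial X {A} ι = record
  { Carrier       = A
  ; Near          = λ k → Near X k on ι
  ; isEquivalence = λ k → On.isEquivalence ι (Space.isEquivalence X k)
  ; antitone      = Space.antitone X
  }

subspace : (X : Space) → Subset X → Space
subspace X C = initial X {∃ C} proj₁

Matrix : Set
Matrix = ℕ → ℕ → Bool

Agree : ℕ → Rel Matrix 0ℓ
Agree k x y = ∀ i j → i < k → j < k → x i j ≡ y i j

2^ℕ×ℕ : Space
2^ℕ×ℕ = record
  { Carrier       = Matrix
  ; Near          = Agree
  ; isEquivalence = λ k → record
    { refl  = λ i j _ _ → refl
    ; sym   = λ p i j i<k j<k → sym (p i j i<k j<k)
    ; trans = λ p q i j i<k j<k → trans (p i j i<k j<k) (q i j i<k j<k)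
    }
  ; antitone      = λ k≤l p i j i<k j<k → p i j (<-≤-trans i<k k≤l) (<-≤-trans j<k k≤l)
  }

module _ (X : Space) (R : Rel (Carrier X) 0ℓ) where

  BorelRel : Set₁
  BorelRel = Borel (X ⊗ X) (uncurry R)

  -- Projecting along the Cantor space loses nothing: all uncountable Polish
  -- spaces are Borel isomorphic.
  AnalyticRel : Set₁
  AnalyticRel = Σ[ P ∈ Subset ((X ⊗ X) ⊗ 2^ℕ×ℕ) ]
    (Borel ((X ⊗ X) ⊗ 2^ℕ×ℕ) P × (∀ x y → R x y ⇔ (∃[ z ] P ((x , y) , z))))

infix 8 _↾_

_↾_ : {A : Set} → Rel A 0ℓ → (C : Pred A 0ℓ) → Rel (∃ C) 0ℓ
R ↾ C = R on proj₁

BorelReducible : (X : Space) → Rel (Carrier X) 0ℓ → (Y : Space) → Rel (Carrier Y) 0ℓ → Set₁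
BorelReducible X E Y F = Σ[ f ∈ (Carrier X → Carrier Y) ]
  (BorelMap X Y f × (∀ x x′ → E x x′ ⇔ F (f x) (f x′)))

BorelBireducible : (X : Space) → Rel (Carrier X) 0ℓ → (Y : Space) → Rel (Carrier Y) 0ℓ → Set₁
BorelBireducible X E Y F = BorelReducible X E Y F × BorelReducible Y F X E

InSpectrum : (X : Space) → Pred (Subset X) 0ℓ → Rel (Carrier X) 0ℓ → Set₁
InSpectrum X 𝓘 F = IsEquivalence F × AnalyticRel X F ×
  (∀ (𝓑 : Subset X) → Borel X 𝓑 → ¬ (𝓑 ∈ 𝓘) →
    Σ[ 𝓒 ∈ Subset X ] (Borel X 𝓒 × 𝓒 ⊆ 𝓑 × ¬ (𝓒 ∈ 𝓘) ×
      BorelBireducible X F (subspace X 𝓒) (F ↾ 𝓒)))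

record 𝓔∞ : Set where
  field
    matrix : Matrix

  _~_ : Rel ℕ 0ℓ
  i ~ j = T (matrix i j)

  field
    isEquivalence : IsEquivalence _~_
    -- An injection of ℕ into the set of classes.
    infinite      : ∃[ f ] Injective {A = ℕ} _≡_ _~_ f

open 𝓔∞ public using (matrix)

𝓔∞-space : Space
𝓔∞-space = initial 2^ℕ×ℕ matrix

class : 𝓔∞ → ℕ → Pred ℕ 0ℓ
class A x y = 𝓔∞._~_ A x y

infix 4 _≤_

-- The class of x in A is the union of the B-classes of the elements of S.
-- S is Bool-valued only to keep the relation in Set.
_≤_ : Rel 𝓔∞ 0ℓ
A ≤ B = ∀ x → Σ[ S ∈ (ℕ → Bool) ] class A x ≐ (λ y → ∃[ z ] (S z ≡ true × y ∈ class B z))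

[_,_]∞ : ℕ → 𝓔∞ → Pred 𝓔∞ 0ℓ
[ m , B ]∞ A = A ≤ B × Agree m (matrix A) (matrix B)

𝓘⟨𝓔∞⟩ : Pred (Subset 𝓔∞-space) 0ℓ
𝓘⟨𝓔∞⟩ 𝓧 = ∀ B m → ∃[ B′ ] (B′ ∈ [ m , B ]∞ × Empty ([ m , B′ ]∞ ∩ 𝓧))

E₁ : Rel Matrix 0ℓ
E₁ x y = ∃[ n₀ ] (∀ n m → x (n₀ + n) m ≡ y (n₀ + n) m)

{-# OPTIONS --safe #-}
module Submission where

-- F compares only the sets of class minima: split the increasing sequence of
-- the minima of A into infinitely many infinite blocks, code the i-th block by
-- the i-th row of a matrix, and pull E₁ back. Only one thing has to be shown:
-- E₁ reduces to F ↾ V whenever V is analytic (in particular Borel) and meets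
-- [ m , B′ ]∞ for all B′ ∈ [ m , B ]∞.
--
-- Since the minima are all that matters, the dual Ramsey theorem can be
-- avoided. Merging classes into the class of 0 shows that for every infinite
-- set Z of minima of B there is a point of V, equal to B below m, whose minima
-- past m lie in Z. A fusion argument over the approximations of V produces an
-- infinite set Y such that, for almost every element q of Y, a stem
-- approximating V can be prolonged to one whose next minimum is q. Histories
-- that disagree in the past can therefore be continued with the same minima,
-- and for each matrix X this yields a point of V whose p-th minimum depends
-- only on p and on the p-th bit of X.

open import Defs
open import Level using (0ℓ)
open import Axiom.ExcludedMiddle using (ExcludedMiddle)
open import Data.Bool.Base using (Bool; true; false; T; if_then_else_)
open import Data.Bool.Properties using (T?; T-≡) renaming (_≟_ to _≟ᵇ_)
open import Data.Fin.Base using (Fin; toℕ; fromℕ<)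
open import Data.Fin.Properties using (pigeonhole; toℕ-fromℕ<)
open import Data.List.Base using (List; []; _∷_; foldr; map; length; upTo; cartesianProduct; _++_)
open import Data.List.Membership.Propositional renaming (_∈_ to _∈ˡ_) using ()
open import Data.List.Membership.Propositional.Properties using (∈-upTo⁺; ∈-cartesianProduct⁺; ∈-map⁺; ∈-++⁺ˡ; ∈-++⁺ʳ)
open import Data.List.Relation.Unary.All as All using (All; []; _∷_)
open import Data.List.Relation.Unary.Any using (here; there)
open import Data.Nat.Base using (ℕ; zero; suc; _+_; _∸_; _⊔_; _≡ᵇ_; _<_; z≤n; s≤s; z<s) renaming (_≤_ to _≤ℕ_)
open import Data.Nat.Properties
open import Data.Product.Base using (_×_; _,_; proj₁; proj₂; ∃; ∃-syntax; Σ-syntax; uncurry) renaming (map to map×)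
open import Data.Sum.Base using (_⊎_; inj₁; inj₂; [_,_]′)
open import Data.Empty using (⊥)
open import Data.Unit.Base using (tt) renaming (⊤ to Unit)
open import Function.Base using (_∘_; id; _on_)
open import Function.Bundles using (_⇔_; mk⇔; module Equivalence)
open import Relation.Binary.Core using (Rel)
open import Relation.Binary.Structures using (IsEquivalence)
import Relation.Binary.Construct.On as On
open import Relation.Binary.Definitions using (tri<; tri≈; tri>)
open import Relation.Binary.PropositionalEquality using (_≡_; refl; sym; trans; cong; cong₂; subst)
open import Relation.Nullary.Decidable using (Dec; ⌊_⌋; yes; no; does; _×-dec_; _⊎-dec_; ¬?)
open import Relation.Nullary.Decidable using (decidable-stable; does-⇔; dec-true; dec-false; toWitness; fromWitness)
open import Relation.Nullary.Negation using (¬_; contradiction)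
open import Relation.Unary using (Pred; _∈_; _⊆_; ∁; ⋃)

-- Cantor's enumeration of ℕ × ℕ along the antidiagonals, each from (s , 0) to (0 , s)

private
  advance : ℕ × ℕ → ℕ × ℕ
  advance (zero  , b) = suc b , zero
  advance (suc a , b) = a , suc b

unpair : ℕ → ℕ × ℕ
unpair zero    = zero , zero
unpair (suc n) = advance (unpair n)

row col : ℕ → ℕ
row = proj₁ ∘ unpair
col = proj₂ ∘ unpair

unpair-sum : ∀ n → row n + col n ≤ℕ n
unpair-sum zero    = z≤n
unpair-sum (suc n) with unpair n | unpair-sum n
... | zero  , b | p = s≤s (subst (_≤ℕ n) (sym (+-identityʳ b)) p)
... | suc a , b | p = m≤n⇒m≤1+n (subst (_≤ℕ n) (sym (+-suc a b)) p)

row≤ : ∀ n → row n ≤ℕ n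
row≤ n = ≤-trans (m≤m+n _ _) (unpair-sum n)

col≤ : ∀ n → col n ≤ℕ n
col≤ n = ≤-trans (m≤n+m _ _) (unpair-sum n)

unpair-onto : ∀ i j → ∃[ n ] unpair n ≡ (i , j)
unpair-onto i j = diagonal i j (start (i + j))
  where
  diagonal : ∀ i j → ∃[ n ] unpair n ≡ (i + j , zero) → ∃[ n ] unpair n ≡ (i , j)
  diagonal i zero    p = subst (λ s → ∃[ n ] unpair n ≡ (s , zero)) (+-identityʳ i) p
  diagonal i (suc j) p
    with n , eq ← diagonal (suc i) j (subst (λ s → ∃[ n ] unpair n ≡ (s , zero)) (+-suc i j) p)
    = suc n , cong advance eq

  start : ∀ s → ∃[ n ] unpair n ≡ (s , zero)
  start zero    = zero , refl
  start (suc s) with n , eq ← diagonal zero s (start s) = suc n , cong advance eq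

pair : ℕ → ℕ → ℕ
pair i j = proj₁ (unpair-onto i j)

unpair-pair : ∀ i j → unpair (pair i j) ≡ (i , j)
unpair-pair i j = proj₂ (unpair-onto i j)

row-pair : ∀ i j → row (pair i j) ≡ i
row-pair i j = cong proj₁ (unpair-pair i j)

col-pair : ∀ i j → col (pair i j) ≡ j
col-pair i j = cong proj₂ (unpair-pair i j)

-- Analytic sets

-- A closed relation between points of X and points of the Baire space, given
-- by its finite approximations; U is the projection of that closed set.
record Analytic (X : Space) (U : Subset X) : Set₁ where
  field
    Approx   : ℕ → Carrier X → (ℕ → ℕ) → Set
    respects : ∀ {k x y u v} → Near X k x y → (∀ i → i < k → u i ≡ v i) → Approx k x u → Approx k y v
    sound    : ∀ {x} → (∃[ u ] (∀ k → Approx k x u)) → x ∈ U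
    complete : ∀ {x} → x ∈ U → ∃[ u ] (∀ k → Approx k x u)

module _ {X : Space} where

  private
    module X k = IsEquivalence (Space.isEquivalence X k)

  analytic-resp : {U V : Subset X} → U ⊆ V → V ⊆ U → Analytic X U → Analytic X V
  analytic-resp U⊆V V⊆U a = record
    { Approx   = Approx
    ; respects = respects
    ; sound    = λ p → U⊆V (sound p)
    ; complete = λ p → complete (V⊆U p)
    } where open Analytic a

  -- The entry `u 0` guesses the radius of a ball around x inside U. The guard `u 0 < k` keeps the
  -- k-th approximation silent until that ball is determined by `Near X k`.
  open⇒analytic : {U : Subset X} → Open X U → Analytic X U
  open⇒analytic {U} U-open = record
    { Approx   = λ k x u → u 0 < k → ∀ y → Near X (u 0) x y → y ∈ U
    ; respects = λ {k} → ball-resp k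
    ; sound    = λ { {x} (u , p) → p (suc (u 0)) ≤-refl x (X.refl (u 0)) }
    ; complete = λ {x} x∈U → let k , ball = U-open x x∈U in (λ _ → k) , λ _ _ → ball
    }
    where
    ball-resp : ∀ k {x y} {u v : ℕ → ℕ} → Near X k x y → (∀ i → i < k → u i ≡ v i) →
           (u 0 < k → ∀ z → Near X (u 0) x z → z ∈ U) → v 0 < k → ∀ z → Near X (v 0) y z → z ∈ U
    ball-resp k {u = u} {v} xy uv p v0<k z yz =
      p (subst (_< k) (sym u0≡v0) v0<k) z
        (subst (λ n → Near X n _ _) (sym u0≡v0) (X.trans (v 0) (Space.antitone X (<⇒≤ v0<k) xy) yz))
      where
      u0≡v0 : u 0 ≡ v 0
      u0≡v0 = uv 0 (≤-<-trans z≤n v0<k)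

  -- A closed set needs no search: the k-th approximation asks for a point of U in the k-ball,
  -- whatever u is.
  limits⇒analytic : {U : Subset X} → (∀ x → (∀ k → ∃[ y ] (Near X k x y × y ∈ U)) → x ∈ U) → Analytic X U
  limits⇒analytic {U} U-closed = record
    { Approx   = λ k x _ → ∃[ y ] (Near X k x y × y ∈ U)
    ; respects = λ { {k} xy _ (z , xz , z∈U) → z , X.trans k (X.sym k xy) xz , z∈U }
    ; sound    = λ { {x} (_ , p) → U-closed x p }
    ; complete = λ {x} x∈U → (λ _ → 0) , λ k → x , X.refl k , x∈U
    }

  -- The entry `u 0` names a set containing x, and the rest of u is a witness for that set; hence
  -- the shift of the approximations by one.
  analytic-union : {U : ℕ → Subset X} → (∀ n → Analytic X (U n)) → Analytic X (⋃ ℕ U)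
  analytic-union {U} a = record
    { Approx   = λ { zero x u → Unit ; (suc k) x u → Approx (u 0) k x (u ∘ suc) }
    ; respects = λ { {zero} _ _ _ → tt
                   ; {suc k} {x} {y} {u} {v} xy uv p → subst (λ n → Approx n k y (v ∘ suc)) (uv 0 z<s)
                       (respects (u 0) (Space.antitone X (n≤1+n k) xy) (λ i i<k → uv (suc i) (s≤s i<k)) p) }
    ; sound    = λ { (u , p) → u 0 , sound (u 0) (u ∘ suc , λ k → p (suc k)) }
    ; complete = λ { (n , x∈U) → let u , p = complete n x∈U in
                       (λ { zero → n ; (suc i) → u i }) , λ { zero → tt ; (suc k) → p k } }
    } where open module A n = Analytic (a n)

  -- One sequence interleaves the witnesses for all `U n`. Stage k imposes the i-th approximation of
  -- `U n` only when i ≤ k and all entries it reads sit at positions below k.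
  analytic-intersection : {U : ℕ → Subset X} → (∀ n → Analytic X (U n)) → Analytic X (λ x → ∀ n → x ∈ U n)
  analytic-intersection {U} a = record
    { Approx   = λ k x u → ∀ n i → i ≤ℕ k → (∀ j → j < i → pair n j < k) → Approx n i x (λ j → u (pair n j))
    ; respects = λ xy uv p n i i≤k q → respects n (Space.antitone X i≤k xy) (λ j j<i → uv _ (q j j<i)) (p n i i≤k q)
    ; sound    = λ { (u , p) n → sound n ((λ j → u (pair n j)) , λ i →
                       let k , q = bound n i in p (i ⊔ k) n i (m≤m⊔n i k) (λ j j<i → <-≤-trans (q j j<i) (m≤n⊔m i k))) }
    ; complete = λ {x} x∈U → merge x∈U , λ k n i _ _ →
                   respects n (X.refl i) (λ j _ → sym (merge-pair x∈U n j)) (proj₂ (complete n (x∈U n)) i)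
    }
    where
    open module A n = Analytic (a n)

    bound : ∀ n i → ∃[ k ] (∀ j → j < i → pair n j < k)
    bound n zero    = 0 , λ _ ()
    bound n (suc i) with k , q ← bound n i =
      suc (pair n i) ⊔ k , λ j j<1+i →
        [ (λ j<i → <-≤-trans (q j j<i) (m≤n⊔m _ k)) , (λ { refl → m≤m⊔n _ k }) ]′ (m<1+n⇒m<n∨m≡n j<1+i)

    merge : ∀ {x} → (∀ n → x ∈ U n) → ℕ → ℕ
    merge x∈U t = proj₁ (complete (row t) (x∈U (row t))) (col t)

    merge-pair : ∀ {x} (x∈U : ∀ n → x ∈ U n) n j → merge x∈U (pair n j) ≡ proj₁ (complete n (x∈U n)) j
    merge-pair x∈U n j = cong (λ (n , j) → proj₁ (complete n (x∈U n)) j) (unpair-pair n j)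

  module _ (em : ExcludedMiddle 0ℓ) where

    -- A set and its complement go through the induction together, since analytic sets are not
    -- closed under complements.
    borel⇒bianalytic : {U : Subset X} → Borel X U → Analytic X U × Analytic X (∁ U)
    borel⇒bianalytic (open-set {U} U-open) = open⇒analytic U-open , limits⇒analytic λ x p x∈U →
      let k , ball = U-open x x∈U ; y , xy , y∉U = p k in y∉U (ball y xy)
    borel⇒bianalytic (complement b) with a , a∁ ← borel⇒bianalytic b =
      a∁ , analytic-resp (λ x∈U x∉U → x∉U x∈U) (decidable-stable em) a
    borel⇒bianalytic (union b) =
      analytic-union (λ n → proj₁ (borel⇒bianalytic (b n))) ,
      analytic-resp (λ { p (n , x∈U) → p n x∈U }) (λ { p n x∈U → p (n , x∈U) })
        (analytic-intersection (λ n → proj₂ (borel⇒bianalytic (b n))))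
    borel⇒bianalytic (resp (U⊆V , V⊆U) b) with a , a∁ ← borel⇒bianalytic b =
      analytic-resp U⊆V V⊆U a , analytic-resp (λ x∉U x∈V → x∉U (V⊆U x∈V)) (λ x∉V x∈U → x∉V (U⊆V x∈U)) a∁

-- Borel maps and reductions

UniformlyContinuous : (X Y : Space) → (Carrier X → Carrier Y) → Set
UniformlyContinuous X Y f = ∀ k → ∃[ l ] (∀ {x y} → Near X l x y → Near Y k (f x) (f y))

borel-preimage : ∀ {X Y f} → UniformlyContinuous X Y f → BorelMap X Y f
borel-preimage {f = f} uc (open-set U-open) = open-set λ x fx∈U →
  let k , ball = U-open (f x) fx∈U ; l , near = uc k in l , λ y xy → ball (f y) (near xy)
borel-preimage uc (complement b)       = complement (borel-preimage uc b)
borel-preimage uc (union b)            = union (λ n → borel-preimage uc (b n))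
borel-preimage uc (resp (U⊆V , V⊆U) b) = resp ((λ p → U⊆V p) , (λ p → V⊆U p)) (borel-preimage uc b)

reducible-trans : ∀ {X Y Z} E F G → BorelReducible X E Y F → BorelReducible Y F Z G → BorelReducible X E Z G
reducible-trans _ _ _ (f , f-borel , f-red) (g , g-borel , g-red) =
  g ∘ f , (λ b → f-borel (g-borel b)) , λ x x′ →
    mk⇔ (λ p → to (g-red _ _) (to (f-red _ _) p)) (λ p → from (f-red _ _) (from (g-red _ _) p))
  where open Equivalence

-- Class minima

module 𝓔 (A : 𝓔∞) where
  open 𝓔∞ A public using (_~_; infinite)
  open IsEquivalence (𝓔∞.isEquivalence A) public renaming (refl to ~-refl; sym to ~-sym; trans to ~-trans)

infix 4 _≈[_]_

-- Wrapped in a record so that both points can be inferred from the type.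
record _≈[_]_ (A : 𝓔∞) (k : ℕ) (B : 𝓔∞) : Set where
  constructor near
  field agree : Agree k (matrix A) (matrix B)

open _≈[_]_ using (agree)

≈-refl : ∀ {k A} → A ≈[ k ] A
≈-refl = near λ _ _ _ _ → refl

≈-sym : ∀ {k A B} → A ≈[ k ] B → B ≈[ k ] A
≈-sym (near p) = near λ i j i<k j<k → sym (p i j i<k j<k)

≈-trans : ∀ {k A B C} → A ≈[ k ] B → B ≈[ k ] C → A ≈[ k ] C
≈-trans (near p) (near q) = near λ i j i<k j<k → trans (p i j i<k j<k) (q i j i<k j<k)

≈-antitone : ∀ {k l A B} → k ≤ℕ l → A ≈[ l ] B → A ≈[ k ] B
≈-antitone k≤l (near p) = near λ i j i<k j<k → p i j (<-≤-trans i<k k≤l) (<-≤-trans j<k k≤l)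

-- The class of 0 is left out so that a class can be removed from the list of
-- minima by merging it into the class of 0.
Lead : 𝓔∞ → ℕ → Set
Lead A j = 0 < j × (∀ {r} → r < j → ¬ T (matrix A r j))

lead? : ∀ A j → Dec (Lead A j)
lead? A j = (0 <? j) ×-dec allUpTo? (λ r → ¬? (T? (matrix A r j))) j

lead-resp : ∀ {A B j k} → j < k → A ≈[ k ] B → Lead A j → Lead B j
lead-resp j<k AB (0<j , new) = 0<j , λ r<j r~j → new r<j (subst T (sym (agree AB _ _ (<-trans r<j j<k) j<k)) r~j)

count : 𝓔∞ → ℕ → ℕ
count A zero    = zero
count A (suc j) = if does (lead? A j) then suc (count A j) else count A j

count-lead : ∀ A {j} → Lead A j → count A (suc j) ≡ suc (count A j)
count-lead A {j} p = cong (λ b → if b then suc (count A j) else count A j) (dec-true (lead? A j) p)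

count-gap : ∀ A {l q} → l ≤ℕ q → (∀ j → l ≤ℕ j → j < q → ¬ Lead A j) → count A q ≡ count A l
count-gap A {zero}  {zero}  _    _   = refl
count-gap A {l}     {suc q} l≤1+q gap with m≤n⇒m<n∨m≡n l≤1+q
... | inj₂ refl = refl
... | inj₁ (s≤s l≤q) = trans
  (cong (λ b → if b then suc (count A q) else count A q) (dec-false (lead? A q) (gap q l≤q ≤-refl)))
  (count-gap A l≤q (λ j l≤j j<q → gap j l≤j (m≤n⇒m≤1+n j<q)))

lead-⇔ : ∀ {A B j k} → j < k → A ≈[ k ] B → Lead A j ⇔ Lead B j
lead-⇔ j<k AB = mk⇔ (lead-resp j<k AB) (lead-resp j<k (≈-sym AB))

count-resp : ∀ {A B} k → A ≈[ k ] B → count A k ≡ count B k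
count-resp zero    _  = refl
count-resp {A} {B} (suc k) AB = cong₂ (λ b c → if b then suc c else c)
  (does-⇔ (lead-⇔ ≤-refl AB) (lead? A k) (lead? B k))
  (count-resp k (≈-antitone (n≤1+n k) AB))

-- Row i records the nonzero class minima whose index lies in the i-th block
-- of the partition of ℕ given by row.
Coded : 𝓔∞ → ℕ → ℕ → Set
Coded A i j = Lead A j × row (count A j) ≡ i

coded? : ∀ A i j → Dec (Coded A i j)
coded? A i j = lead? A j ×-dec (row (count A j) ≟ i)

code : 𝓔∞ → Matrix
code A i j = does (coded? A i j)

coded-resp : ∀ {A B i j k} → j < k → A ≈[ k ] B → Coded A i j → Coded B i j
coded-resp j<k AB (p , q) =
  lead-resp j<k AB p , trans (cong row (sym (count-resp _ (≈-antitone (<⇒≤ j<k) AB)))) q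

code-≡ : ∀ A B i j → (Coded A i j → Coded B i j) → (Coded B i j → Coded A i j) → code A i j ≡ code B i j
code-≡ A B i j f g = does-⇔ (mk⇔ f g) (coded? A i j) (coded? B i j)

code-transfer : ∀ A B i j → code A i j ≡ code B i j → Coded A i j → Coded B i j
code-transfer A B i j eq c = decidable-stable (coded? B i j) λ ¬d →
  contradiction (trans (sym (dec-true (coded? A i j) c)) (trans eq (dec-false (coded? B i j) ¬d))) λ ()

-- Whether j is a minimum, and in which block its index falls, depends only on A below j + 1; so k
-- is its own modulus.
code-continuous : UniformlyContinuous 𝓔∞-space 2^ℕ×ℕ code
code-continuous k = k , λ {A} {B} AB i j _ j<k →
  code-≡ A B i j (coded-resp j<k (near AB)) (coded-resp j<k (≈-sym (near AB)))

F : Rel 𝓔∞ 0ℓ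
F = E₁ on code

-- Least representatives and coarsenings

module Representatives (A : 𝓔∞) where
  open 𝓔 A

  abstract
    -- Descend to a smaller equivalent element as long as there is one; `n` bounds the recursion.
    representative : ∀ n x → x < n → ∃[ r ] (r ≤ℕ x × r ~ x × (∀ {s} → s < r → ¬ s ~ r))
    representative (suc n) x (s≤s x≤n) with anyUpTo? (λ r → T? (matrix A r x)) x
    ... | no none = x , ≤-refl , ~-refl , λ s<x s~x → none (_ , s<x , s~x)
    ... | yes (y , y<x , y~x) with r , r≤y , r~y , min ← representative n y (<-≤-trans y<x x≤n) =
      r , ≤-trans r≤y (<⇒≤ y<x) , ~-trans r~y y~x , min

  rep : ℕ → ℕ
  rep x = proj₁ (representative (suc x) x ≤-refl)

  rep≤ : ∀ x → rep x ≤ℕ x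
  rep≤ x = proj₁ (proj₂ (representative (suc x) x ≤-refl))

  rep~ : ∀ x → rep x ~ x
  rep~ x = proj₁ (proj₂ (proj₂ (representative (suc x) x ≤-refl)))

  rep-minimal : ∀ x {s} → s < rep x → ¬ s ~ rep x
  rep-minimal x = proj₂ (proj₂ (proj₂ (representative (suc x) x ≤-refl)))

  rep-lead : ∀ x → 0 < rep x → Lead A (rep x)
  rep-lead x 0<r = 0<r , rep-minimal x

  rep-cong : ∀ {x y} → x ~ y → rep x ≡ rep y
  rep-cong {x} {y} x~y with <-cmp (rep x) (rep y)
  ... | tri≈ _ eq _ = eq
  ... | tri< lt _ _ = contradiction (~-trans (rep~ x) (~-trans x~y (~-sym (rep~ y)))) (rep-minimal y lt)
  ... | tri> _ _ gt = contradiction (~-trans (rep~ y) (~-trans (~-sym x~y) (~-sym (rep~ x)))) (rep-minimal x gt)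

  rep-injective : ∀ {x y} → rep x ≡ rep y → x ~ y
  rep-injective {x} {y} eq = ~-trans (~-sym (rep~ x)) (subst (_~ y) (sym eq) (rep~ y))

  rep-of-lead : ∀ {q} → Lead A q → rep q ≡ q
  rep-of-lead {q} (_ , new) with m≤n⇒m<n∨m≡n (rep≤ q)
  ... | inj₁ lt = contradiction (rep~ q) (new lt)
  ... | inj₂ eq = eq

  -- Otherwise all representatives are at most n, and two of n + 2 pairwise inequivalent points
  -- share one.
  leads-unbounded : ExcludedMiddle 0ℓ → ∀ n → ∃[ q ] (n ≤ℕ q × Lead A q)
  leads-unbounded em n = decidable-stable em λ none →
    let f , f-inj = infinite
        small x = s≤s (≮⇒≥ λ n<r → none (rep x , <⇒≤ n<r , rep-lead x (≤-<-trans z≤n n<r)))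
        i , j , i<j , eq = pigeonhole ≤-refl (λ (i : Fin (2 + n)) → fromℕ< (small (f (toℕ i))))
    in <-irrefl (f-inj (rep-injective (trans (sym (toℕ-fromℕ< (small (f (toℕ i)))))
         (trans (cong toℕ eq) (toℕ-fromℕ< (small (f (toℕ j)))))))) i<j

-- Together with `coarsening` this turns `A ≤ B` into the inclusion of B in A as relations.
refines : ∀ {A B} → A ≤ B → ∀ {x y} → T (matrix B x y) → T (matrix A x y)
refines {A} {B} A≤B {x} {y} xy with S , to , from ← A≤B x with z , Sz , zx ← to {x} (𝓔.~-refl A) =
  from (z , Sz , 𝓔.~-trans B zx xy)

coarsening : ∀ {A B} → (∀ {x y} → T (matrix B x y) → T (matrix A x y)) → A ≤ B
-- The class of x in A serves as its own index set of B-classes.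
coarsening {A} {B} B⊆A x = matrix A x ,
  (λ {y} xy → y , Equivalence.to T-≡ xy , 𝓔.~-refl B) ,
  λ { (z , xz , zy) → 𝓔.~-trans A (Equivalence.from T-≡ xz) (B⊆A zy) }

-- A smaller element equivalent to j in B stays equivalent to j in A.
lead-coarse : ∀ {A B} → A ≤ B → ∀ {j} → Lead A j → Lead B j
lead-coarse {A} {B} A≤B (0<j , new) = 0<j , λ r<j r~j → new r<j (refines {A} {B} A≤B r~j)

-- Refinement is a condition on single entries and agreement one on the entries below m, so a near
-- enough member of the cube settles each instance.
cube-closed : ∀ m B → Analytic 𝓔∞-space [ m , B ]∞
cube-closed m B = limits⇒analytic λ A lim →
  coarsening {A} {B} (λ {x} {y} xy →
    let A′ , AA′ , A′≤B , _ = lim (suc (x ⊔ y))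
    in subst T (sym (AA′ x y (s≤s (m≤m⊔n x y)) (s≤s (m≤n⊔m x y)))) (refines {A′} {B} A′≤B xy)) ,
  let A′ , AA′ , _ , A′B = lim m in agree (≈-trans {A = A} {A′} {B} (near AA′) (near A′B))

-- Infinite subsets of ℕ modulo finite sets

record InfiniteSet : Set where
  field
    member    : ℕ → Bool
    unbounded : ∀ n → ∃[ q ] (n ≤ℕ q × T (member q))

open InfiniteSet using (unbounded)

infix 4 _∋_ _⊆*_

_∋_ : InfiniteSet → ℕ → Set
Y ∋ q = T (InfiniteSet.member Y q)

record _⊆*_ (Z Y : InfiniteSet) : Set where
  constructor almost
  field
    bound  : ℕ
    subset : ∀ q → bound ≤ℕ q → Z ∋ q → Y ∋ q

⊆*-refl : ∀ {Y} → Y ⊆* Y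
⊆*-refl = almost 0 λ _ _ y → y

⊆*-trans : ∀ {X Y Z} → X ⊆* Y → Y ⊆* Z → X ⊆* Z
⊆*-trans (almost M X⊆Y) (almost N Y⊆Z) = almost (M ⊔ N) λ q le x →
  Y⊆Z q (≤-trans (m≤n⊔m M N) le) (X⊆Y q (≤-trans (m≤m⊔n M N) le) x)

-- `h` is a growth demand: each term bounds all later terms from below by its value under `h`.
module IncreasingSequence {P : ℕ → ℕ → Set} (P-unbounded : ∀ i n → ∃[ q ] (n ≤ℕ q × P i q)) (n₀ : ℕ) (h : ℕ → ℕ) where

  private
    choice : ∀ i → ∃[ q ] P i q
    choice zero    = let q , _ , p = P-unbounded zero n₀ in q , p
    choice (suc i) = let z = proj₁ (choice i) ; q , _ , p = P-unbounded (suc i) (suc z ⊔ h z) in q , p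

  seq : ℕ → ℕ
  seq i = proj₁ (choice i)

  seq-satisfies : ∀ i → P i (seq i)
  seq-satisfies i = proj₂ (choice i)

  seq-start : n₀ ≤ℕ seq 0
  seq-start = proj₁ (proj₂ (P-unbounded zero n₀))

  private
    seq-step : ∀ i → suc (seq i) ⊔ h (seq i) ≤ℕ seq (suc i)
    seq-step i = proj₁ (proj₂ (P-unbounded (suc i) _))

  seq-gap : ∀ {i j} → i < j → suc (seq i) ⊔ h (seq i) ≤ℕ seq j
  seq-gap {i} {suc j} (s≤s i≤j) with m≤n⇒m<n∨m≡n i≤j
  ... | inj₂ refl = seq-step i
  ... | inj₁ i<j  = ≤-trans (seq-gap i<j) (≤-trans (n≤1+n _) (≤-trans (m≤m⊔n (suc (seq j)) (h (seq j))) (seq-step j)))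

  seq-mono : ∀ {i j} → i < j → seq i < seq j
  seq-mono {i} i<j = ≤-trans (m≤m⊔n (suc (seq i)) (h (seq i))) (seq-gap i<j)

  seq-cancel : ∀ {i j} → seq i < seq j → i < j
  seq-cancel {i} {j} lt with <-cmp i j
  ... | tri< i<j _ _    = i<j
  ... | tri≈ _ refl _   = contradiction lt (<-irrefl refl)
  ... | tri> _ _ j<i    = contradiction lt (<-asym (seq-mono j<i))

  i≤seq : ∀ i → i ≤ℕ seq i
  i≤seq zero    = z≤n
  i≤seq (suc i) = ≤-<-trans (i≤seq i) (seq-mono ≤-refl)

-- Finitely many stems of each length, uniform density and fusion

net : ℕ → List (𝓔∞ → Bool)
net k = map (λ (i , j) A → matrix A i j) (cartesianProduct (upTo k) (upTo k))

-- Finitely many Boolean tests determine a stem of length k. This lets a requirement be met for all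
-- stems of one length at once.
net-separates : ∀ k A B → All (λ t → t A ≡ t B) (net k) → A ≈[ k ] B
net-separates k A B same = near λ i j i<k j<k →
  All.lookup same (∈-map⁺ (λ (i , j) A → matrix A i j) (∈-cartesianProduct⁺ (∈-upTo⁺ i<k) (∈-upTo⁺ j<k)))

decode : ℕ → ℕ → List ℕ
decode zero    _ = []
decode (suc k) n = row n ∷ decode k (col n)

decode-onto : ∀ u → ∃[ k ] ∃[ n ] decode k n ≡ u
decode-onto []      = 0 , 0 , refl
decode-onto (n ∷ u) with k , c , eq ← decode-onto u =
  suc k , pair n c , cong₂ _∷_ (row-pair n c) (trans (cong (decode k) (col-pair n c)) eq)

module Classical (em : ExcludedMiddle 0ℓ) where

  collect : (P : ℕ → Set) → (∀ n → ∃[ q ] (n ≤ℕ q × P q)) → InfiniteSet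
  collect P P-unbounded = record
    { member    = λ q → ⌊ em {P q} ⌋
    ; unbounded = λ n → let q , n≤q , p = P-unbounded n in q , n≤q , fromWitness p
    }

  module _ {A S : Set} {_≼_ : Rel S 0ℓ} (≼-refl : ∀ {s} → s ≼ s) (≼-trans : ∀ {s t u} → s ≼ t → t ≼ u → s ≼ u)
           {P : A → S → Set} (P-mono : ∀ {a s t} → s ≼ t → P a s → P a t)
           (P-dense : ∀ a s → ∃[ t ] (s ≼ t × P a t)) where

    private
      on-part : (tests : List (A → Bool)) (K : A → Set) →
                (∀ {a b s} → K a → K b → All (λ t → t a ≡ t b) tests → P a s → P b s) →
                ∀ s → ∃[ t ] (s ≼ t × (∀ a → K a → P a t))
      -- With the tests used up, P cannot tell the elements of K apart, so serving one of them
      -- serves all.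
      on-part [] K inv s with em {∃ K}
      ... | no none     = s , ≼-refl , λ a k → contradiction (a , k) none
      ... | yes (a , k) with t , s≼t , p ← P-dense a s = t , s≼t , λ b k′ → inv k k′ [] p
      on-part (test ∷ tests) K inv s
        with t , s≼t , p ← on-part tests (λ a → K a × test a ≡ true)
               (λ (k , e) (k′ , e′) same → inv k k′ (trans e (sym e′) ∷ same)) s
        with u , t≼u , q ← on-part tests (λ a → K a × test a ≡ false)
               (λ (k , e) (k′ , e′) same → inv k k′ (trans e (sym e′) ∷ same)) t
        = u , ≼-trans s≼t t≼u , covers
        where
        covers : ∀ a → K a → P a u
        covers a k with test a in e
        ... | true  = P-mono t≼u (p a (k , e))
        ... | false = q a (k , e)

    -- The tests split A into finitely many parts. They are served one after another, and `P-mono`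
    -- preserves what was achieved earlier.
    uniformly-dense : (tests : List (A → Bool)) → (∀ {a b s} → All (λ t → t a ≡ t b) tests → P a s → P b s) →
                      ∀ s → ∃[ t ] (s ≼ t × (∀ a → P a t))
    uniformly-dense tests inv s with t , s≼t , p ← on-part tests (λ _ → Unit) (λ _ _ → inv) s =
      t , s≼t , λ a → p a tt

  -- Meet the requirements one by one along an almost decreasing sequence `Ys`, then take a
  -- pseudo-intersection: its i-th element lies in each of `Ys 0`, ..., `Ys i`.
  fusion : {P : ℕ → InfiniteSet → Set} → (∀ {i Y Z} → Z ⊆* Y → P i Y → P i Z) →
           (∀ i Y → ∃[ Z ] (Z ⊆* Y × P i Z)) → ∀ Y → ∃[ Z ] (Z ⊆* Y × (∀ i → P i Z))
  fusion {P} P-mono P-dense Y = Ŷ , Ŷ⊆* 0 , λ i → P-mono (Ŷ⊆* (suc i)) (proj₂ (proj₂ (P-dense i (Ys i))))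
    where
    Ys : ℕ → InfiniteSet
    Ys zero    = Y
    Ys (suc i) = proj₁ (P-dense i (Ys i))

    tail-in-all : ∀ i → ∃[ N ] (∀ q → N ≤ℕ q → Ys i ∋ q → ∀ j → j ≤ℕ i → Ys j ∋ q)
    tail-in-all zero    = 0 , λ { _ _ y zero z≤n → y }
    tail-in-all (suc i) with almost M Ysuc⊆Y ← proj₁ (proj₂ (P-dense i (Ys i))) with N , tail ← tail-in-all i =
      M ⊔ N , λ q le y j j≤1+i →
        let M≤q = ≤-trans (m≤m⊔n M N) le ; N≤q = ≤-trans (m≤n⊔m M N) le in
        [ (λ { (s≤s j≤i) → tail q N≤q (Ysuc⊆Y q M≤q y) j j≤i }) , (λ { refl → y }) ]′ (m≤n⇒m<n∨m≡n j≤1+i)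

    common : ∀ i n → ∃[ q ] (n ≤ℕ q × (∀ j → j ≤ℕ i → Ys j ∋ q))
    common i n = let N , tail = tail-in-all i ; q , le , y = unbounded (Ys i) (n ⊔ N) in
      q , ≤-trans (m≤m⊔n n N) le , tail q (≤-trans (m≤n⊔m n N) le) y

    open IncreasingSequence common 0 id

    Ŷ : InfiniteSet
    Ŷ = collect (λ q → ∃[ i ] seq i ≡ q) (λ n → seq n , i≤seq n , n , refl)

    Ŷ⊆* : ∀ i → Ŷ ⊆* Ys i
    Ŷ⊆* i = almost (seq i) λ q le y → let j , eq = toWitness y in
      subst (Ys i ∋_) eq (seq-satisfies j i (≮⇒≥ λ j<i → <⇒≱ (seq-mono j<i) (subst (seq i ≤ℕ_) (sym eq) le)))

  thin : ∀ Y n₀ (h : ℕ → ℕ) → ∃[ Z ] ((∀ {q} → Z ∋ q → n₀ ≤ℕ q × Y ∋ q) × (∀ {p q} → Z ∋ p → Z ∋ q → p < q → h p ≤ℕ q))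
  thin Y n₀ h = collect (λ q → ∃[ i ] seq i ≡ q) (λ n → seq n , i≤seq n , n , refl) ,
    (λ z → let i , eq = toWitness z in subst (λ q → n₀ ≤ℕ q × Y ∋ q) eq (above i , seq-satisfies i)) ,
    λ z z′ p<q → let i , eq = toWitness z ; j , eq′ = toWitness z′ in
      gap i j eq eq′ p<q
    where
    open IncreasingSequence {λ _ q → Y ∋ q} (λ _ → unbounded Y) n₀ h
    above : ∀ i → n₀ ≤ℕ seq i
    above zero    = seq-start
    above (suc i) = ≤-trans (above i) (<⇒≤ (seq-mono {i} ≤-refl))
    gap : ∀ i j {p q} → seq i ≡ p → seq j ≡ q → p < q → h p ≤ℕ q
    gap i j refl refl p<q = ≤-trans (m≤n⊔m (suc (seq i)) (h (seq i))) (seq-gap (seq-cancel {i} {j} p<q))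

  -- There are countably many pairs (u , l), which `fusion` enumerates, and for each pair only
  -- finitely many points A up to `≈[ l ]`, which `uniformly-dense` serves together.
  fusion-on-stems : {P : List ℕ → ℕ → 𝓔∞ → InfiniteSet → Set} →
    (∀ {u l A Y Z} → Z ⊆* Y → P u l A Y → P u l A Z) →
    (∀ {u l A B Y} → A ≈[ l ] B → P u l A Y → P u l B Y) →
    (∀ u l A Y → ∃[ Z ] (Z ⊆* Y × P u l A Z)) →
    ∀ Y → ∃[ Z ] (Z ⊆* Y × (∀ u l A → P u l A Z))
  fusion-on-stems {P} P-mono P-inv P-dense Y =
    let Z , Z⊆Y , p = fusion {λ i Y → ∀ A → P (word i) (row i) A Y} (λ le q A → P-mono le (q A)) all-stems Y
    in Z , Z⊆Y , λ u l A →
      let k , n , eq = decode-onto u in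
      subst (λ u → P u l A Z) (trans (cong (λ (_ , c) → decode (row c) (col c)) (unpair-pair l (pair k n)))
                                (trans (cong (λ (k , n) → decode k n) (unpair-pair k n)) eq))
        (subst (λ l′ → P (word (pair l (pair k n))) l′ A Z) (row-pair l (pair k n)) (p (pair l (pair k n)) A))
    where
    -- The index i codes the stem length in its row, and the length and code of the sequence in its
    -- column.
    word : ℕ → List ℕ
    word i = decode (row (col i)) (col (col i))

    all-stems : ∀ i Y → ∃[ Z ] (Z ⊆* Y × (∀ A → P (word i) (row i) A Z))
    all-stems i = uniformly-dense {_≼_ = λ Y Z → Z ⊆* Y} ⊆*-refl (λ p q → ⊆*-trans q p)
      P-mono (λ A Y → P-dense (word i) (row i) A Y) (net (row i))
      (λ {A} {B} same → P-inv (net-separates (row i) A B same))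

-- Finite sequences and prolongations of stems

at : List ℕ → ℕ → ℕ
-- A default past the length; `≺` and `⊑` compare entries only below it.
at []      _ = 0
at (n ∷ u) i = if does (i ≟ length u) then n else at u i

at-head : ∀ n u → at (n ∷ u) (length u) ≡ n
at-head n u = cong (λ b → if b then n else at u (length u)) (dec-true (length u ≟ length u) refl)

at-tail : ∀ n u {i} → i < length u → at (n ∷ u) i ≡ at u i
at-tail n u {i} i<k = cong (λ b → if b then n else at u i) (dec-false (i ≟ length u) (<⇒≢ i<k))

-- Finite sequences are listed with the last entry first.
_≺_ : List ℕ → (ℕ → ℕ) → Set
u ≺ v = ∀ i → i < length u → v i ≡ at u i

≺-extend : ∀ {u v} → u ≺ v → (v (length u) ∷ u) ≺ v
≺-extend {u} {v} u≺v i i<1+k with m<1+n⇒m<n∨m≡n i<1+k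
... | inj₁ i<k  = trans (u≺v i i<k) (sym (at-tail _ u i<k))
... | inj₂ refl = sym (at-head _ u)

-- The stem of A below l is prolonged to the stem of B below q + 1, with q as its only new minimum.
Next : ℕ → 𝓔∞ → ℕ → 𝓔∞ → Set
Next l A q B = A ≈[ l ] B × l ≤ℕ q × Lead B q × (∀ j → l ≤ℕ j → j < q → ¬ Lead B j)

-- Limits of stems and the coding of E₁

module Limit {A : ℕ → 𝓔∞} {l q : ℕ → ℕ} (next : ∀ p → Next (l p) (A p) (q p) (A (suc p)))
             (l-suc : ∀ p → l (suc p) ≡ suc (q p)) where

  private
    l≤q : ∀ p → l p ≤ℕ q p
    l≤q p = proj₁ (proj₂ (next p))

    q<l : ∀ p → q p < l (suc p)
    q<l p = ≤-reflexive (sym (l-suc p))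

    l-mono : ∀ {p p′} → p ≤ℕ p′ → l p ≤ℕ l p′
    l-mono {p} {p′} p≤p′ with m≤n⇒m<n∨m≡n p≤p′
    l-mono _ | inj₂ refl = ≤-refl
    l-mono {p′ = suc p′} _ | inj₁ (s≤s p≤p′) = ≤-trans (l-mono p≤p′) (≤-trans (l≤q p′) (<⇒≤ (q<l p′)))

    p≤l : ∀ p → p ≤ℕ l p
    p≤l zero    = z≤n
    p≤l (suc p) = ≤-<-trans (≤-trans (p≤l p) (l≤q p)) (q<l p)

    q-mono : ∀ {p p′} → p < p′ → q p < q p′
    q-mono {p} {p′} p<p′ = <-≤-trans (q<l p) (≤-trans (l-mono p<p′) (l≤q p′))

    stable : ∀ {p p′} → p ≤ℕ p′ → A p ≈[ l p ] A p′
    stable {p} {p′} p≤p′ with m≤n⇒m<n∨m≡n p≤p′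
    stable _ | inj₂ refl = ≈-refl
    stable {p′ = suc p′} _ | inj₁ (s≤s p≤p′) =
      ≈-trans (stable p≤p′) (≈-antitone (l-mono p≤p′) (proj₁ (next p′)))

    limit-matrix : Matrix
    -- Stage p has length at least p, so stage i ⊔ j + 1 already decides this entry.
    limit-matrix i j = matrix (A (suc (i ⊔ j))) i j

    limit-at : ∀ p {i j} → i < l p → j < l p → limit-matrix i j ≡ matrix (A p) i j
    limit-at p {i} {j} i<l j<l with ≤-total (suc (i ⊔ j)) p
    ... | inj₁ le = agree (stable le) i j (<-≤-trans (s≤s (m≤m⊔n i j)) (p≤l _)) (<-≤-trans (s≤s (m≤n⊔m i j)) (p≤l _))
    ... | inj₂ ge = sym (agree (stable ge) i j i<l j<l)

    q-lead : ∀ p → Lead (A (suc p)) (q p)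
    q-lead p = proj₁ (proj₂ (proj₂ (next p)))

    q-separated : ∀ {p p′} → p < p′ → ¬ T (limit-matrix (q p) (q p′))
    q-separated {p} {p′} p<p′ t = proj₂ (q-lead p′) (q-mono p<p′)
      (subst T (limit-at (suc p′) (<-trans (q-mono p<p′) (q<l p′)) (q<l p′)) t)

    limit-sym : ∀ {i j} → T (limit-matrix i j) → T (limit-matrix j i)
    limit-sym {i} {j} t = subst T (sym (limit-at p (<-≤-trans (s≤s (m≤n⊔m i j)) (p≤l p)) (<-≤-trans (s≤s (m≤m⊔n i j)) (p≤l p))))
      (𝓔.~-sym (A p) t)
      where p = suc (i ⊔ j)

    limit-trans : ∀ {i j k} → T (limit-matrix i j) → T (limit-matrix j k) → T (limit-matrix i k)
    limit-trans {i} {j} {k} t t′ = subst T (sym (limit-at p i< k<))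
      (𝓔.~-trans (A p) (subst T (limit-at p i< j<) t) (subst T (limit-at p j< k<) t′))
      where
      p = suc (i ⊔ j ⊔ k)
      i< : i < l p
      i< = <-≤-trans (s≤s (≤-trans (m≤m⊔n i j) (m≤m⊔n (i ⊔ j) k))) (p≤l p)
      j< : j < l p
      j< = <-≤-trans (s≤s (≤-trans (m≤n⊔m i j) (m≤m⊔n (i ⊔ j) k))) (p≤l p)
      k< : k < l p
      k< = <-≤-trans (s≤s (m≤n⊔m (i ⊔ j) k)) (p≤l p)

    q-injective : ∀ {p p′} → T (limit-matrix (q p) (q p′)) → p ≡ p′
    q-injective {p} {p′} t with <-cmp p p′
    ... | tri≈ _ eq _ = eq
    ... | tri< lt _ _ = contradiction t (q-separated lt)
    ... | tri> _ _ gt = contradiction (limit-sym {q p} {q p′} t) (q-separated gt)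

  limit : 𝓔∞
  limit = record
    { matrix        = limit-matrix
    ; isEquivalence = record
      { refl  = λ {i} → 𝓔.~-refl (A (suc (i ⊔ i)))
      ; sym   = λ {i} {j} → limit-sym {i} {j}
      ; trans = λ {i} {j} {k} → limit-trans {i} {j} {k}
      }
    ; infinite      = q , q-injective
    }

  limit-near : ∀ p → A p ≈[ l p ] limit
  limit-near p = near λ i j i<l j<l → sym (limit-at p i<l j<l)

  limit-lead : ∀ p → Lead limit (q p)
  limit-lead p = lead-resp (q<l p) (limit-near (suc p)) (q-lead p)

  -- Go down through the stages: a minimum below `l (suc p)` is `q p` or lies below `l p`, since the
  -- gap between `l p` and `q p` contains none.
  limit-leads : ∀ {j} → l 0 ≤ℕ j → Lead limit j → ∃[ p ] j ≡ q p
  limit-leads {j} l₀≤j lead = search (suc j) (p≤l (suc j)) (lead-resp (p≤l (suc j)) (≈-sym (limit-near (suc j))) lead)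
    where
    search : ∀ p → j < l p → Lead (A p) j → ∃[ p ] j ≡ q p
    search zero    j<l _    = contradiction l₀≤j (<⇒≱ j<l)
    search (suc p) j<l lead with m<1+n⇒m<n∨m≡n (subst (j <_) (l-suc p) j<l)
    ... | inj₂ j≡q = p , j≡q
    ... | inj₁ j<q with j <? l p
    ...   | yes j<l′ = search p j<l′ (lead-resp j<l′ (≈-sym (proj₁ (next p))) lead)
    ...   | no ¬j<l  = contradiction lead (proj₂ (proj₂ (proj₂ (next p))) j (≮⇒≥ ¬j<l) j<q)

  l₀≤q : ∀ p → l 0 ≤ℕ q p
  l₀≤q p = ≤-trans (l-mono z≤n) (l≤q p)

  -- Each stage adds exactly one minimum, so indices start from the number of minima below `l 0`.
  limit-count : ∀ p → count limit (q p) ≡ count (A 0) (l 0) + p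
  limit-count p = trans (count-resp (q p) (≈-antitone (<⇒≤ (q<l p)) (≈-sym (limit-near (suc p)))))
                    (trans (before p) (upto p))
    where
    before : ∀ p → count (A (suc p)) (q p) ≡ count (A p) (l p)
    before p = trans (count-gap (A (suc p)) (l≤q p) (proj₂ (proj₂ (proj₂ (next p)))))
                     (count-resp (l p) (≈-sym (proj₁ (next p))))
    upto : ∀ p → count (A p) (l p) ≡ count (A 0) (l 0) + p
    upto zero    = sym (+-identityʳ _)
    upto (suc p) = trans (cong (count (A (suc p))) (l-suc p)) (trans (count-lead (A (suc p)) (q-lead p))
                     (trans (cong suc (trans (before p) (upto p))) (sym (+-suc _ p))))

module Coding {V : Subset 𝓔∞-space} (m c : ℕ) (pick : ℕ → Bool → ℕ)
              (pick-injective : ∀ {p p′ a b} → pick p a ≡ pick p′ b → p ≡ p′ × a ≡ b)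
              (g : (ℕ → Bool) → 𝓔∞) (g∈V : ∀ x → g x ∈ V)
              (g-cong : ∀ {x y : ℕ → Bool} k → (∀ i → i < k → x i ≡ y i) → g x ≈[ k ] g y)
              (g-near : ∀ x y → g x ≈[ m ] g y)
              (m≤pick : ∀ (x : ℕ → Bool) p → m ≤ℕ pick p (x p))
              (pick-lead : ∀ x p → Lead (g x) (pick p (x p)))
              (leads : ∀ x {j} → m ≤ℕ j → Lead (g x) j → ∃[ p ] j ≡ pick p (x p))
              (pick-count : ∀ x p → count (g x) (pick p (x p)) ≡ c + p) where

  private
    -- The minimum picked at p has index c + p among the nonzero minima, hence is coded in row
    -- `row (c + p)`. It is made to carry an entry of X from that same row.
    bits : Matrix → ℕ → Bool
    bits X p = X (row (c + p)) (col (c + p))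

    bits-pair : ∀ X {p i j} → unpair (c + p) ≡ (i , j) → bits X p ≡ X i j
    bits-pair X eq = cong (uncurry X) eq

    pick-coded : ∀ x {p i} → row (c + p) ≡ i → Coded (g x) i (pick p (x p))
    pick-coded x {p} eq = pick-lead x p , trans (cong row (pick-count x p)) eq

    -- Below m all points `g x` coincide. From m on, a minimum coded in a row carries an entry from
    -- that row, where X and X′ agree.
    forth : ∀ X X′ {n₀ n j} → (∀ n j → X (n₀ + n) j ≡ X′ (n₀ + n) j) →
            Coded (g (bits X)) (n₀ + n) j → Coded (g (bits X′)) (n₀ + n) j
    forth X X′ {n₀} {n} {j} same coded@(lead , in-row) with j <? m
    ... | yes j<m = coded-resp j<m (g-near (bits X) (bits X′)) coded
    ... | no ¬j<m with p , refl ← leads (bits X) (≮⇒≥ ¬j<m) lead =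
      subst (λ b → Coded (g (bits X′)) (n₀ + n) (pick p b)) (sym same-bit) (pick-coded (bits X′) row≡)
      where
      row≡ : row (c + p) ≡ n₀ + n
      row≡ = trans (cong row (sym (pick-count (bits X) p))) in-row
      same-bit : bits X p ≡ bits X′ p
      same-bit = trans (cong (λ i → X i (col (c + p))) row≡)
                   (trans (same n (col (c + p))) (cong (λ i → X′ i (col (c + p))) (sym row≡)))

    -- The minimum carrying the entry (i , j) of X is coded for X′ too. There it must be a picked
    -- minimum, and injectivity of `pick` recovers its position and its bit.
    back : ∀ X X′ {i} j → c ≤ℕ i → (∀ t → code (g (bits X)) i t ≡ code (g (bits X′)) i t) → X i j ≡ X′ i j
    back X X′ {i} j c≤i same =
      let p′ , eq = leads (bits X′) (m≤pick (bits X) p) (proj₁ coded′)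
          p≡p′ , bit≡ = pick-injective eq
      in trans (sym (bits-pair X at-p)) (trans bit≡ (trans (cong (bits X′) (sym p≡p′)) (bits-pair X′ at-p)))
      where
      p : ℕ
      -- The subtraction is exact because c ≤ i ≤ `pair i j`.
      p = pair i j ∸ c
      at-p : unpair (c + p) ≡ (i , j)
      at-p = trans (cong unpair (m+[n∸m]≡n (≤-trans c≤i (subst (_≤ℕ pair i j) (row-pair i j) (row≤ (pair i j))))))
               (unpair-pair i j)
      coded′ : Coded (g (bits X′)) i (pick p (bits X p))
      coded′ = code-transfer (g (bits X)) (g (bits X′)) i (pick p (bits X p)) (same (pick p (bits X p)))
                 (pick-coded (bits X) (cong proj₁ at-p))

  E₁-reduction : BorelReducible 2^ℕ×ℕ E₁ (subspace 𝓔∞-space V) (F ↾ V)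
  E₁-reduction = (λ X → g (bits X) , g∈V (bits X)) ,
    -- The bits before k read entries whose row and column are at most c + p for some p < k.
    borel-preimage (λ k → c + k , λ XX′ → agree (g-cong k λ p p<k →
      XX′ _ _ (≤-<-trans (row≤ _) (+-monoʳ-< c p<k)) (≤-<-trans (col≤ _) (+-monoʳ-< c p<k)))) ,
    λ X X′ → mk⇔
      (λ (n₀ , same) → n₀ , λ n j → code-≡ (g (bits X)) (g (bits X′)) (n₀ + n) j
        (forth X X′ same) (forth X′ X (λ n j → sym (same n j))))
      -- The first c indices carry no bits; in rows from c on, every entry has a code of at least c.
      (λ (n₀ , same) → n₀ + c , λ n j → back X X′ j (≤-trans (m≤n+m c n₀) (m≤m+n (n₀ + c) n))
        (subst (λ i → ∀ t → code (g (bits X)) i t ≡ code (g (bits X′)) i t) (sym (+-assoc n₀ c n)) (same (c + n))))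

-- Merging classes into the class of 0

module Merge (B : 𝓔∞) (m : ℕ) (Z : InfiniteSet) (cofinal : ∀ n → ∃[ q ] (n ≤ℕ q × (Lead B q × Z ∋ q))) where

  open 𝓔 B
  open Representatives B

  private
    -- Minima below m are kept whatever Z is, so that the restriction below m survives.
    Kept : ℕ → Set
    Kept r = r < m ⊎ Z ∋ r

    kept? : ∀ r → Dec (Kept r)
    kept? r = (r <? m) ⊎-dec T? (InfiniteSet.member Z r)

    target : ℕ → ℕ
    target x = if does (kept? (rep x)) then rep x else 0

    target-kept : ∀ {x} → Kept (rep x) → target x ≡ rep x
    target-kept {x} k = cong (λ b → if b then rep x else 0) (dec-true (kept? (rep x)) k)

    target-merged : ∀ {x} → ¬ Kept (rep x) → target x ≡ 0
    target-merged {x} ¬k = cong (λ b → if b then rep x else 0) (dec-false (kept? (rep x)) ¬k)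

    target-0 : target 0 ≡ 0
    target-0 with kept? (rep 0)
    ... | yes k = trans (target-kept k) (n≤0⇒n≡0 (rep≤ 0))
    ... | no ¬k = target-merged ¬k

    target-lead : ∀ {q} → Lead B q → Z ∋ q → target q ≡ q
    target-lead {q} lead z = trans (target-kept (inj₂ (subst (Z ∋_) (sym (rep-of-lead lead)) z))) (rep-of-lead lead)

    target-cong : ∀ {x y} → x ~ y → target x ≡ target y
    target-cong x~y = cong (λ r → if does (kept? r) then r else 0) (rep-cong x~y)

    open IncreasingSequence {λ _ q → Lead B q × Z ∋ q} (λ _ → cofinal) 0 id

  merged : 𝓔∞
  merged = record
    { matrix        = λ x y → target x ≡ᵇ target y
    ; isEquivalence = record
      { refl  = λ {x} → ≡⇒≡ᵇ (target x) (target x) refl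
      ; sym   = λ {x} {y} t → ≡⇒≡ᵇ (target y) (target x) (sym (≡ᵇ⇒≡ (target x) (target y) t))
      ; trans = λ {x} {y} {z} t t′ → ≡⇒≡ᵇ (target x) (target z)
          (trans (≡ᵇ⇒≡ (target x) (target y) t) (≡ᵇ⇒≡ (target y) (target z) t′))
      }
    ; infinite      = seq , λ {i} {j} t → seq-injective
        (trans (sym (fixed i)) (trans (≡ᵇ⇒≡ (target (seq i)) (target (seq j)) t) (fixed j)))
    }
    where
    fixed : ∀ i → target (seq i) ≡ seq i
    fixed i = uncurry target-lead (seq-satisfies i)
    seq-injective : ∀ {i j} → seq i ≡ seq j → i ≡ j
    seq-injective {i} {j} eq with <-cmp i j
    ... | tri≈ _ i≡j _ = i≡j
    ... | tri< lt _ _  = contradiction eq (<⇒≢ (seq-mono lt))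
    ... | tri> _ _ gt  = contradiction (sym eq) (<⇒≢ (seq-mono gt))

  merged≤ : merged ≤ B
  merged≤ = coarsening {merged} {B} λ {x} {y} x~y → ≡⇒≡ᵇ (target x) (target y) (target-cong x~y)

  merged∈cube : merged ∈ [ m , B ]∞
  merged∈cube = merged≤ , λ x y x<m y<m → does-⇔
    (mk⇔ (λ t → rep-injective (trans (sym (target-kept (inj₁ (≤-<-trans (rep≤ x) x<m))))
                  (trans (≡ᵇ⇒≡ (target x) (target y) t) (target-kept (inj₁ (≤-<-trans (rep≤ y) y<m))))))
         (λ t → ≡⇒≡ᵇ (target x) (target y) (target-cong t)))
    (T? (matrix merged x y)) (T? (matrix B x y))

  -- A minimum j ≥ m outside Z would be the minimum of a B-class that was merged into the class of
  -- 0.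
  merged-leads : ∀ {j} → m ≤ℕ j → Lead merged j → Z ∋ j
  merged-leads {j} m≤j lead@(0<j , new) = decidable-stable (T? _) λ ¬z →
    let rep≡ = rep-of-lead (lead-coarse {merged} {B} merged≤ lead)
        ¬kept = subst (λ r → ¬ Kept r) (sym rep≡) [ ≤⇒≯ m≤j , ¬z ]′
    in new 0<j (≡⇒≡ᵇ (target 0) (target j) (trans target-0 (sym (target-merged ¬kept))))

-- Ramsey theory of analytic sets relative to the class minima

module Ramsey (em : ExcludedMiddle 0ℓ) {V : Subset 𝓔∞-space} (V-analytic : Analytic 𝓔∞-space V) where

  open Classical em
  open Analytic V-analytic

  -- Membership of E in V with a witness that begins with u.
  record Through (u : List ℕ) (E : 𝓔∞) : Set where
    constructor through
    field
      witness  : ℕ → ℕ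
      extends  : u ≺ witness
      approx   : ∀ k → Approx k E witness

  Meets : InfiniteSet → List ℕ → ℕ → 𝓔∞ → Set
  Meets Z u l A = ∃[ E ] (A ≈[ l ] E × Through u E × (∀ {j} → l ≤ℕ j → Lead E j → Z ∋ j))

  -- The bound N discards a finite part of Y, which makes the existence of such an N stable under
  -- passing to almost subsets.
  Avoids : ℕ → InfiniteSet → List ℕ → ℕ → 𝓔∞ → Set
  Avoids N Y u l A = ∀ E → A ≈[ l ] E → Through u E → ¬ (∀ {j} → l ≤ℕ j → Lead E j → N ≤ℕ j × Y ∋ j)

  Positive : InfiniteSet → List ℕ → ℕ → 𝓔∞ → Set
  Positive Y u l A = ∀ Z → Z ⊆* Y → Meets Z u l A

  Settled : List ℕ → ℕ → 𝓔∞ → InfiniteSet → Set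
  Settled u l A Y = Positive Y u l A ⊎ (∃[ N ] Avoids N Y u l A)

  positive-mono : ∀ {Y Z u l A} → Z ⊆* Y → Positive Y u l A → Positive Z u l A
  positive-mono Z⊆Y p W W⊆Z = p W (⊆*-trans W⊆Z Z⊆Y)

  positive-resp : ∀ {Y u l A B} → A ≈[ l ] B → Positive Y u l A → Positive Y u l B
  positive-resp AB p Z Z⊆Y =
    let E , AE , rest = p Z Z⊆Y in E , ≈-trans (≈-sym AB) AE , rest

  avoids-mono : ∀ {N M Y u l A} → N ≤ℕ M → Avoids N Y u l A → Avoids M Y u l A
  avoids-mono N≤M p E AE t q = p E AE t λ l≤j lead → let M≤j , y = q l≤j lead in ≤-trans N≤M M≤j , y

  avoids-resp : ∀ {N Y u l A B} → A ≈[ l ] B → Avoids N Y u l A → Avoids N Y u l B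
  avoids-resp AB p E BE = p E (≈-trans AB BE)

  settled-mono : ∀ {u l A Y Z} → Z ⊆* Y → Settled u l A Y → Settled u l A Z
  settled-mono {Y = Y} {Z} Z⊆Y (inj₁ p) = inj₁ (positive-mono Z⊆Y p)
  settled-mono (almost M Z⊆Y) (inj₂ (N , p)) = inj₂ (M ⊔ N , λ E AE t q → p E AE t λ l≤j lead →
    let le , z = q l≤j lead in ≤-trans (m≤n⊔m M N) le , Z⊆Y _ (≤-trans (m≤m⊔n M N) le) z)

  settled-resp : ∀ {u l A B Y} → A ≈[ l ] B → Settled u l A Y → Settled u l B Y
  settled-resp     AB (inj₁ p)       = inj₁ (positive-resp AB p)
  settled-resp {Y = Y} AB (inj₂ (N , p)) = inj₂ (N , avoids-resp {Y = Y} AB p)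

  -- An almost subset in which the stem is not met avoids it outright; if there is none, Y is
  -- positive.
  settled-dense : ∀ u l A Y → ∃[ Z ] (Z ⊆* Y × Settled u l A Z)
  settled-dense u l A Y with em {∃[ Z ] (Z ⊆* Y × ¬ Meets Z u l A)}
  ... | yes (Z , Z⊆Y , none) = Z , Z⊆Y , inj₂ (0 , λ E AE t q → none (E , AE , t , λ l≤j lead → proj₂ (q l≤j lead)))
  ... | no none              = Y , ⊆*-refl , inj₁ λ Z Z⊆Y → decidable-stable em λ ¬m → none (Z , Z⊆Y , ¬m)

  -- A strategy for lengthening u: whatever almost all elements of Y are
  -- prescribed one by one as the next minima, after finitely many of them
  -- u has been extended with the new stem still positive.
  mutual
    data Ranked (Y : InfiniteSet) (u : List ℕ) (l : ℕ) (A : 𝓔∞) : Set where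
      ranked : ∀ N → (∀ q → N ≤ℕ q → Y ∋ q → Step Y u l A q) → Ranked Y u l A

    data Step (Y : InfiniteSet) (u : List ℕ) (l : ℕ) (A : 𝓔∞) (q : ℕ) : Set where
      extend : ∀ B → Next l A q B → ∀ n → Positive Y (n ∷ u) (suc q) B → Step Y u l A q
      wait   : ∀ B → Next l A q B → Ranked Y u (suc q) B → Step Y u l A q

  next-resp : ∀ {l A B q C} → A ≈[ l ] B → Next l A q C → Next l B q C
  next-resp AB (AC , rest) = ≈-trans (≈-sym AB) AC , rest

  step-resp : ∀ {Y u l A B q} → A ≈[ l ] B → Step Y u l A q → Step Y u l B q
  step-resp AB (extend C nx n p) = extend C (next-resp AB nx) n p
  step-resp AB (wait C nx r)     = wait C (next-resp AB nx) r

  ranked-resp : ∀ {Y u l A B} → A ≈[ l ] B → Ranked Y u l A → Ranked Y u l B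
  ranked-resp AB (ranked N f) = ranked N λ q le y → step-resp AB (f q le y)

  mutual
    ranked-mono : ∀ {Y Z u l A} → Z ⊆* Y → Ranked Y u l A → Ranked Z u l A
    ranked-mono Z⊆Y@(almost M sub) (ranked N f) = ranked (M ⊔ N) λ q le z →
      step-mono Z⊆Y (f q (≤-trans (m≤n⊔m M N) le) (sub q (≤-trans (m≤m⊔n M N) le) z))

    step-mono : ∀ {Y Z u l A q} → Z ⊆* Y → Step Y u l A q → Step Z u l A q
    step-mono Z⊆Y (extend B nx n p) = extend B nx n (positive-mono Z⊆Y p)
    step-mono Z⊆Y (wait B nx r)     = wait B nx (ranked-mono Z⊆Y r)

  -- The hereditary negation of `Ranked`, so that both alternatives of `Classified` pass to almost
  -- subsets.
  Unranked : InfiniteSet → List ℕ → ℕ → 𝓔∞ → Set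
  Unranked Y u l A = ∀ Z → Z ⊆* Y → ¬ Ranked Z u l A

  Classified : List ℕ → ℕ → 𝓔∞ → InfiniteSet → Set
  Classified u l A Y = Ranked Y u l A ⊎ Unranked Y u l A

  classified-mono : ∀ {u l A Y Z} → Z ⊆* Y → Classified u l A Y → Classified u l A Z
  classified-mono Z⊆Y (inj₁ r) = inj₁ (ranked-mono Z⊆Y r)
  classified-mono Z⊆Y (inj₂ r) = inj₂ λ W W⊆Z → r W (⊆*-trans W⊆Z Z⊆Y)

  classified-dense : ∀ u l A Y → ∃[ Z ] (Z ⊆* Y × Classified u l A Z)
  classified-dense u l A Y with em {∃[ Z ] (Z ⊆* Y × Ranked Z u l A)}
  ... | yes (Z , Z⊆Y , r) = Z , Z⊆Y , inj₁ r
  ... | no none           = Y , ⊆*-refl , inj₂ λ Z Z⊆Y r → none (Z , Z⊆Y , r)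

  unranked-resp : ∀ {Y u l A B} → A ≈[ l ] B → Unranked Y u l A → Unranked Y u l B
  unranked-resp AB r Z Z⊆Y rB = r Z Z⊆Y (ranked-resp (≈-sym AB) rB)

  classified-resp : ∀ {u l A B Y} → A ≈[ l ] B → Classified u l A Y → Classified u l B Y
  classified-resp AB (inj₁ r) = inj₁ (ranked-resp AB r)
  classified-resp AB (inj₂ r) = inj₂ (unranked-resp AB r)

  bounded-choice : (P : ℕ → ℕ → Set) → (∀ {n M N} → M ≤ℕ N → P n M → P n N) → (∀ n → ∃[ N ] P n N) →
                   ∀ l → ∃[ N ] (∀ n → n ≤ℕ l → P n N)
  bounded-choice P P-mono choice zero = let N , p = choice 0 in N , λ { _ z≤n → p }
  bounded-choice P P-mono choice (suc l) =
    let M , p = bounded-choice P P-mono choice l ; N , q = choice (suc l) in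
    M ⊔ N , λ n n≤1+l →
      [ (λ { (s≤s n≤l) → P-mono (m≤m⊔n M N) (p n n≤l) }) , (λ { refl → P-mono (m≤n⊔m M N) q }) ]′ (m≤n⇒m<n∨m≡n n≤1+l)

  module Decided {Y : InfiniteSet} (settled : ∀ u l A → Settled u l A Y) (classified : ∀ u l A → Classified u l A Y) where

    Blocked : List ℕ → ℕ → 𝓔∞ → ℕ → Set
    Blocked u l A N = ∀ q → N ≤ℕ q → Y ∋ q → ∀ B → Next l A q B →
      (∀ n → ¬ Positive Y (n ∷ u) (suc q) B) × Unranked Y u (suc q) B

    -- If steps existed for unboundedly many q in Y, these q would form an infinite subset of Y on
    -- which the stem is ranked. So steps fail from some N on, and `classified` upgrades the failure
    -- of ranks to `Unranked`.
    unranked⇒blocked : ∀ {u l A} → Unranked Y u l A → ∃[ N ] Blocked u l A N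
    unranked⇒blocked {u} {l} {A} unranked with em {∃[ N ] (∀ q → N ≤ℕ q → Y ∋ q → ¬ Step Y u l A q)}
    ... | yes (N , no-step) = N , λ q le y B nx →
      (λ n p → no-step q le y (extend B nx n p)) ,
      [ (λ r → contradiction (wait B nx r) (no-step q le y)) , id ]′ (classified u (suc q) B)
    ... | no none = contradiction (ranked 0 λ q _ z → step-mono Z⊆Y (proj₂ (toWitness z))) (unranked Z Z⊆Y)
      where
      Z : InfiniteSet
      Z = collect (λ q → Y ∋ q × Step Y u l A q)
            (λ n → decidable-stable em λ ¬q → none (n , λ q n≤q y st → ¬q (q , n≤q , y , st)))
      Z⊆Y : Z ⊆* Y
      Z⊆Y = almost 0 λ q _ z → proj₁ (toWitness z)

    -- Restricting to n ≤ l leaves finitely many extensions of u, whose bounds can be joined; each n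
    -- is covered once the stem is long enough.
    Barrier : List ℕ → ℕ → 𝓔∞ → ℕ → Set
    Barrier u l A N = (Unranked Y u l A → Blocked u l A N) ×
                      (∀ n → n ≤ℕ l → ¬ Positive Y (n ∷ u) l A → Avoids N Y (n ∷ u) l A)

    -- There are finitely many stems of length l, so one height serves all A.
    barrier : ∀ u l → ∃[ N ] (∀ A → Barrier u l A N)
    barrier u l =
      let N , _ , b = uniformly-dense {_≼_ = _≤ℕ_} ≤-refl ≤-trans {P = Barrier u l} barrier-mono barrier-dense (net l)
                        (λ {A} {B} same → barrier-resp (net-separates l A B same)) 0
      in N , b
      where
      barrier-mono : ∀ {A M N} → M ≤ℕ N → Barrier u l A M → Barrier u l A N
      barrier-mono le (b , a) = (λ r q N≤q → b r q (≤-trans le N≤q)) , λ n n≤l ¬p → avoids-mono {Y = Y} le (a n n≤l ¬p)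

      barrier-resp : ∀ {A B N} → A ≈[ l ] B → Barrier u l A N → Barrier u l B N
      barrier-resp AB (b , a) =
        (λ r q le y C nx → b (unranked-resp (≈-sym AB) r) q le y C (next-resp (≈-sym AB) nx)) ,
        λ n n≤l ¬p → avoids-resp {Y = Y} AB (a n n≤l (λ p → ¬p (positive-resp AB p)))

      blocked : ∀ A → ∃[ N ] (Unranked Y u l A → Blocked u l A N)
      blocked A with em {Unranked Y u l A}
      ... | yes r = let N , b = unranked⇒blocked r in N , λ _ → b
      ... | no ¬r = 0 , λ r → contradiction r ¬r

      avoids : ∀ A n → ∃[ N ] (¬ Positive Y (n ∷ u) l A → Avoids N Y (n ∷ u) l A)
      avoids A n with settled (n ∷ u) l A
      ... | inj₁ p       = 0 , contradiction p
      ... | inj₂ (N , a) = N , λ _ → a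

      barrier-dense : ∀ A M → ∃[ N ] (M ≤ℕ N × Barrier u l A N)
      barrier-dense A M =
        let N , b = blocked A
            K , a = bounded-choice (λ n N → ¬ Positive Y (n ∷ u) l A → Avoids N Y (n ∷ u) l A)
                      (λ le f ¬p → avoids-mono {Y = Y} le (f ¬p)) (avoids A) l
        in M ⊔ (N ⊔ K) , m≤m⊔n M (N ⊔ K) ,
           barrier-mono (m≤n⊔m M (N ⊔ K))
             ((λ r q le → b r q (≤-trans (m≤m⊔n N K) le)) , λ n n≤l ¬p → avoids-mono {Y = Y} (m≤n⊔m N K) (a n n≤l ¬p))

    -- A point E whose minima past an unranked stem are spread so thinly that
    -- they jump over all barriers: all its longer stems are unranked and none
    -- of them is positive for a one-step extension of u, yet E passes through
    -- one of these extensions.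
    module Escape {u l E} (height : ℕ → ℕ) (is-barrier : ∀ l A → Barrier u l A (height l))
                  (E-through : Through u E) (unranked : Unranked Y u l E)
                  (in-Y : ∀ {j} → l ≤ℕ j → Lead E j → Y ∋ j)
                  (high : ∀ {j} → l ≤ℕ j → Lead E j → height l ≤ℕ j)
                  (spread : ∀ {p q} → l ≤ℕ p → Lead E p → Lead E q → p < q → height (suc p) ≤ℕ q) where

      open Through E-through renaming (witness to v; extends to u≺v; approx to v-approx)

      -- As produced by `stem-at`, `end` is l or one past the last minimum of E before j.
      record Stem (j : ℕ) : Set where
        constructor stem
        field
          {end}         : ℕ
          end≤          : end ≤ℕ j
          ≤end          : l ≤ℕ end
          gap           : ∀ i → end ≤ℕ i → i < j → ¬ Lead E i
          end-unranked  : Unranked Y u end E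
          far           : ∀ {q} → end ≤ℕ q → Lead E q → height end ≤ℕ q

        blocked : Lead E j → (∀ n → ¬ Positive Y (n ∷ u) (suc j) E) × Unranked Y u (suc j) E
        blocked lead = proj₁ (is-barrier end E) end-unranked j (far end≤ lead) (in-Y (≤-trans ≤end end≤) lead) E
                         (≈-refl , end≤ , lead , gap)

      stem-at : ∀ j → l ≤ℕ j → Stem j
      stem-at j l≤j with m≤n⇒m<n∨m≡n l≤j
      stem-at j l≤j | inj₂ refl = stem ≤-refl ≤-refl (λ i l≤i i<l → contradiction l≤i (<⇒≱ i<l)) unranked high
      stem-at (suc j) _ | inj₁ (s≤s l≤j) with lead? E j
      ... | yes lead = stem ≤-refl (m≤n⇒m≤1+n l≤j) (λ i j<i i<1+j → contradiction j<i (<⇒≱ i<1+j))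
                         (proj₂ (Stem.blocked (stem-at j l≤j) lead)) (λ j<q lead′ → spread l≤j lead lead′ j<q)
      ... | no ¬lead with stem end≤ ≤end gap r far ← stem-at j l≤j =
        stem (m≤n⇒m≤1+n end≤) ≤end
          (λ i end≤i i<1+j → [ gap i end≤i , (λ { refl → ¬lead }) ]′ (m<1+n⇒m<n∨m≡n i<1+j)) r far

      absurd : ⊥
      absurd =
        -- Here n is the entry by which the witness of E continues u. The minimum q is taken above
        -- n, so that the barrier at length q + 1 covers n ∷ u; it forbids exactly the point E.
        let n = v (length u)
            q , l⊔n≤q , lead = Representatives.leads-unbounded E em (l ⊔ n)
            l≤q = ≤-trans (m≤m⊔n l n) l⊔n≤q
        in proj₂ (is-barrier (suc q) E) n (m≤n⇒m≤1+n (≤-trans (m≤n⊔m l n) l⊔n≤q))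
             (proj₁ (Stem.blocked (stem-at q l≤q) lead) n)
             E ≈-refl (through v (≺-extend {u} {v} u≺v) v-approx)
             (λ q<j lead′ → spread l≤q lead lead′ q<j , in-Y (≤-trans l≤q (<⇒≤ q<j)) lead′)

    -- Thin Y until its elements jump over the barrier heights. Positivity yields a point E with
    -- minima in the thinned set, and `Escape` refutes it.
    unranked⇒¬positive : ∀ {u l A} → Unranked Y u l A → ¬ Positive Y u l A
    unranked⇒¬positive {u} {l} {A} unranked positive =
      let height = λ l → proj₁ (barrier u l)
          Z , within , spread = thin Y (height l) (height ∘ suc)
          E , AE , E-through , in-Z = positive Z (almost 0 λ q _ z → proj₂ (within z))
      in Escape.absurd height (λ l → proj₂ (barrier u l)) E-through (unranked-resp AE unranked)
           (λ l≤j lead → proj₂ (within (in-Z l≤j lead)))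
           (λ l≤j lead → proj₁ (within (in-Z l≤j lead)))
           (λ l≤p lead lead′ p<q → spread (in-Z l≤p lead) (in-Z (≤-trans l≤p (<⇒≤ p<q)) lead′) p<q)

    positive⇒ranked : ∀ {u l A} → Positive Y u l A → Ranked Y u l A
    positive⇒ranked {u} {l} {A} p = [ id , (λ r → contradiction p (unranked⇒¬positive r)) ]′ (classified u l A)

    -- The tree of prolongations

    record State : Set where
      constructor state
      field
        word  : List ℕ
        len   : ℕ
        point : 𝓔∞
        rank  : Ranked Y word len point

    open State

    threshold : State → ℕ
    threshold (state _ _ _ (ranked N _)) = N

    move : ∀ s q → threshold s ≤ℕ q → Y ∋ q → Step Y (word s) (len s) (point s) q
    move (state _ _ _ (ranked _ f)) = f

    after : ∀ {u l A q} → Step Y u l A q → State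
    after {u} {l} {A} {q} (extend B _ n p) = state (n ∷ u) (suc q) B (positive⇒ranked p)
    after {u} {l} {A} {q} (wait B _ r)     = state u (suc q) B r

    after-next : ∀ {u l A q} (st : Step Y u l A q) → Next l A q (point (after st))
    after-next (extend _ nx _ _) = nx
    after-next (wait _ nx _)     = nx

    after-len : ∀ {u l A q} (st : Step Y u l A q) → len (after st) ≡ suc q
    after-len (extend _ _ _ _) = refl
    after-len (wait _ _ _)     = refl

    infix 4 _⊑_

    record _⊑_ (u u′ : List ℕ) : Set where
      constructor prefix
      field
        shorter : length u ≤ℕ length u′
        same    : ∀ i → i < length u → at u′ i ≡ at u i

    ⊑-refl : ∀ {u} → u ⊑ u
    ⊑-refl = prefix ≤-refl λ _ _ → refl

    ⊑-trans : ∀ {u v w} → u ⊑ v → v ⊑ w → u ⊑ w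
    ⊑-trans (prefix a b) (prefix c d) = prefix (≤-trans a c) λ i i<k → trans (d i (<-≤-trans i<k a)) (b i i<k)

    after-word : ∀ {u l A q} (st : Step Y u l A q) → u ⊑ word (after st)
    after-word {u} (extend _ _ n _) = prefix (n≤1+n _) λ i → at-tail n u
    after-word     (wait _ _ _)     = ⊑-refl

    -- For an inadmissible q the state stays put as a default; the stages below prescribe admissible
    -- values only.
    go : State → ℕ → State
    go s q with threshold s ≤? q | T? (InfiniteSet.member Y q)
    ... | yes N≤q | yes y = after (move s q N≤q y)
    ... | _       | _     = s

    go-after : ∀ s {q} → threshold s ≤ℕ q → Y ∋ q → ∃[ le ] ∃[ y ] go s q ≡ after (move s q le y)
    go-after s {q} N≤q y with threshold s ≤? q | T? (InfiniteSet.member Y q)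
    ... | yes le | yes y′ = le , y′ , refl
    ... | no ¬le | _      = contradiction N≤q ¬le
    ... | yes _  | no ¬y  = contradiction y ¬y

    -- `states` lists the states after all histories of one length. Being finitely many, their
    -- thresholds have a common bound, and two elements of Y beyond it serve as candidates. `floor`
    -- keeps these above all earlier candidates.
    record Stage : Set where
      constructor stage
      field
        states : List State
        floor  : ℕ

      ceiling : ℕ
      ceiling = foldr (λ s n → threshold s ⊔ n) floor states

      lo hi : ℕ
      lo = proj₁ (unbounded Y ceiling)
      hi = proj₁ (unbounded Y (suc lo))

      choose : Bool → ℕ
      choose b = if b then hi else lo

      choose∈Y : ∀ b → Y ∋ choose b
      choose∈Y false = proj₂ (proj₂ (unbounded Y ceiling))
      choose∈Y true  = proj₂ (proj₂ (unbounded Y (suc lo)))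

      lo<hi : lo < hi
      lo<hi = proj₁ (proj₂ (unbounded Y (suc lo)))

      choose≤hi : ∀ b → choose b ≤ℕ hi
      choose≤hi false = <⇒≤ lo<hi
      choose≤hi true  = ≤-refl

      ceiling≤choose : ∀ b → ceiling ≤ℕ choose b
      ceiling≤choose false = proj₁ (proj₂ (unbounded Y ceiling))
      ceiling≤choose true  = ≤-trans (ceiling≤choose false) (<⇒≤ lo<hi)

      choose-injective : ∀ {a b} → choose a ≡ choose b → a ≡ b
      choose-injective {false} {false} _  = refl
      choose-injective {true}  {true}  _  = refl
      choose-injective {false} {true}  eq = contradiction eq (<⇒≢ lo<hi)
      choose-injective {true}  {false} eq = contradiction (sym eq) (<⇒≢ lo<hi)

    open Stage using (states; floor; ceiling; hi; choose)

    floor≤ceiling : ∀ L → floor L ≤ℕ ceiling L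
    floor≤ceiling (stage []       f) = ≤-refl
    floor≤ceiling (stage (s ∷ ss) f) = ≤-trans (floor≤ceiling (stage ss f)) (m≤n⊔m (threshold s) _)

    threshold≤ceiling : ∀ {s} L → s ∈ˡ states L → threshold s ≤ℕ ceiling L
    threshold≤ceiling (stage (s ∷ ss) f) (here refl) = m≤m⊔n (threshold s) _
    threshold≤ceiling (stage (s ∷ ss) f) (there s∈)  = ≤-trans (threshold≤ceiling (stage ss f) s∈) (m≤n⊔m (threshold s) _)

    above : Stage → Stage
    above L = stage
      (map (λ s → go s (choose L false)) (states L) ++ map (λ s → go s (choose L true)) (states L))
      (suc (hi L))

    go∈above : ∀ {s} L b → s ∈ˡ states L → go s (choose L b) ∈ˡ states (above L)
    go∈above L false s∈ = ∈-++⁺ˡ (∈-map⁺ _ s∈)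
    go∈above L true  s∈ = ∈-++⁺ʳ (map (λ s → go s (choose L false)) (states L)) (∈-map⁺ _ s∈)

    -- All histories of length p share the same two candidates for their next
    -- minimum, so the minima of a branch depend only on the current bit.
    module Tree (root : State) where

      stages : ℕ → Stage
      stages zero    = stage (root ∷ []) 0
      stages (suc p) = above (stages p)

      pick : ℕ → Bool → ℕ
      pick p = choose (stages p)

      pick-mono : ∀ {p p′} a b → p < p′ → pick p a < pick p′ b
      pick-mono {p} {suc p′} a b (s≤s p≤p′) =
        ≤-trans below (≤-trans (floor≤ceiling (stages (suc p′))) (Stage.ceiling≤choose (stages (suc p′)) b))
        where
        below : pick p a < floor (stages (suc p′))
        below with m≤n⇒m<n∨m≡n p≤p′
        ... | inj₂ refl = s≤s (Stage.choose≤hi (stages p) a)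
        ... | inj₁ p<p′ = m≤n⇒m≤1+n (<-≤-trans (pick-mono a true p<p′) ≤-refl)

      pick-injective : ∀ {p p′ a b} → pick p a ≡ pick p′ b → p ≡ p′ × a ≡ b
      pick-injective {p} {p′} {a} {b} eq with <-cmp p p′
      ... | tri≈ _ refl _ = refl , Stage.choose-injective (stages p) eq
      ... | tri< lt _ _   = contradiction eq (<⇒≢ (pick-mono a b lt))
      ... | tri> _ _ gt   = contradiction (sym eq) (<⇒≢ (pick-mono b a gt))

      path : (ℕ → Bool) → ℕ → State
      path x zero    = root
      path x (suc p) = go (path x p) (pick p (x p))

      path∈ : ∀ x p → path x p ∈ˡ states (stages p)
      path∈ x zero    = here refl
      path∈ x (suc p) = go∈above (stages p) (x p) (path∈ x p)

      path-cong : ∀ {x y} p → (∀ i → i < p → x i ≡ y i) → path x p ≡ path y p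
      path-cong zero    _  = refl
      path-cong (suc p) xy = cong₂ (λ s b → go s (pick p b)) (path-cong p (λ i i<p → xy i (m≤n⇒m≤1+n i<p))) (xy p ≤-refl)

      module Branch (x : ℕ → Bool) where

        bit : ℕ → ℕ
        bit p = pick p (x p)

        threshold≤ : ∀ p → threshold (path x p) ≤ℕ bit p
        threshold≤ p = ≤-trans (threshold≤ceiling (stages p) (path∈ x p)) (Stage.ceiling≤choose (stages p) (x p))

        path-after : ∀ p → ∃[ le ] ∃[ y ] path x (suc p) ≡ after (move (path x p) (bit p) le y)
        path-after p = go-after (path x p) (threshold≤ p) (Stage.choose∈Y (stages p) (x p))

        path-next : ∀ p → Next (len (path x p)) (point (path x p)) (bit p) (point (path x (suc p)))
        path-next p = let le , y , eq = path-after p in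
          subst (λ s → Next (len (path x p)) (point (path x p)) (bit p) (point s)) (sym eq)
            (after-next (move (path x p) (bit p) le y))

        path-len : ∀ p → len (path x (suc p)) ≡ suc (bit p)
        path-len p = let le , y , eq = path-after p in trans (cong len eq) (after-len (move (path x p) (bit p) le y))

        path-word : ∀ {p p′} → p ≤ℕ p′ → word (path x p) ⊑ word (path x p′)
        path-word {p} {p′} p≤p′ with m≤n⇒m<n∨m≡n p≤p′
        path-word _ | inj₂ refl = ⊑-refl
        path-word {p} {suc p′} _ | inj₁ (s≤s p≤p′) = ⊑-trans (path-word p≤p′)
          (let le , y , eq = path-after p′ in
           subst (λ s → word (path x p′) ⊑ word s) (sym eq) (after-word (move (path x p′) (bit p′) le y)))

        PositiveState : State → Set
        PositiveState s = Positive Y (word s) (len s) (point s)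

        Extends : ℕ → List ℕ → Set
        Extends p u = ∃[ p′ ] (p < p′ × length u < length (word (path x p′)) × PositiveState (path x p′))

        mutual
          -- Induction on the rank: every `wait` passes to a subtree, so the branch reaches an
          -- `extend`.
          eventually-extends : ∀ p {u l A} (r : Ranked Y u l A) → path x p ≡ state u l A r → Extends p u
          eventually-extends p {u} {l} {A} r@(ranked N f) eq =
            let N≤q = subst (λ s → threshold s ≤ℕ bit p) eq (threshold≤ p)
                le , y , eq′ = go-after (state u l A r) N≤q (Stage.choose∈Y (stages p) (x p))
            in extends-after p (f (bit p) le y) (trans (cong (λ s → go s (bit p)) eq) eq′)

          extends-after : ∀ p {u l A q} (st : Step Y u l A q) → path x (suc p) ≡ after st → Extends p u
          extends-after p {u} (extend B nx n pos) eq = suc p , ≤-refl ,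
            subst (λ s → length u < length (word s)) (sym eq) ≤-refl , subst PositiveState (sym eq) pos
          extends-after p (wait B nx r) eq =
            let p′ , p<p′ , rest = eventually-extends (suc p) r eq in p′ , <⇒≤ p<p′ , rest

        module _ (root-positive : PositiveState root) where

          positive-at : ∀ k → ∃[ p ] (k ≤ℕ p × k ≤ℕ length (word (path x p)) × PositiveState (path x p))
          positive-at zero    = 0 , z≤n , z≤n , root-positive
          positive-at (suc k) =
            let p , k≤p , k≤u , _ = positive-at k
                p′ , p<p′ , u<u′ , pos = eventually-extends p (rank (path x p)) refl
            in p′ , ≤-<-trans k≤p p<p′ , ≤-<-trans k≤u u<u′ , pos

          limit-witness : ℕ → ℕ
          limit-witness i = at (word (path x (proj₁ (positive-at (suc i))))) i

          words-below : ∀ p → word (path x p) ≺ limit-witness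
          words-below p i i<u with ≤-total p (proj₁ (positive-at (suc i)))
          ... | inj₁ p≤p′ = _⊑_.same (path-word p≤p′) i i<u
          ... | inj₂ p′≤p = sym (_⊑_.same (path-word p′≤p) i (proj₁ (proj₂ (proj₂ (positive-at (suc i))))))

          open Limit path-next path-len using (limit; limit-near)

          -- At a positive state of length and word length at least k, positivity supplies a point
          -- of V with a witness. Both agree below k with the limit and `limit-witness`, so the k-th
          -- approximation carries over.
          limit∈V : limit ∈ V
          limit∈V = sound (limit-witness , λ k →
            let p , k≤p , k≤u , pos = positive-at k
                E , AE , through v u≺v v-approx , _ = pos Y ⊆*-refl
            in respects (agree (≈-antitone (≤-trans k≤p (p≤len p)) (≈-trans (≈-sym AE) (limit-near p))))
                 (λ i i<k → trans (u≺v i (<-≤-trans i<k k≤u)) (sym (words-below p i (<-≤-trans i<k k≤u)))) (v-approx k))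
            where
            p≤len : ∀ p → p ≤ℕ len (path x p)
            p≤len zero    = z≤n
            p≤len (suc p) = subst (suc p ≤ℕ_) (sym (path-len p)) (s≤s (≤-trans (p≤len p) (proj₁ (proj₂ (path-next p)))))

    reduction-from-positive : ∀ {m B} → Positive Y [] m B → BorelReducible 2^ℕ×ℕ E₁ (subspace 𝓔∞-space V) (F ↾ V)
    reduction-from-positive {m} {B} positive = Coding.E₁-reduction m (count B m) pick pick-injective
      L.limit (λ x → Branch.limit∈V x positive)
      -- The entry (i , j) of the limit is read off at stage i ⊔ j + 1, which depends only on the
      -- bits up to i ⊔ j.
      (λ {x} {y} k xy → near λ i j i<k j<k → cong (λ s → matrix (point s) i j)
        (path-cong (suc (i ⊔ j)) (λ p p≤i⊔j → xy p (<-≤-trans p≤i⊔j (⊔-lub i<k j<k)))))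
      (λ x y → ≈-trans (≈-sym (L.limit-near x 0)) (L.limit-near y 0))
      L.l₀≤q L.limit-lead L.limit-leads L.limit-count
      where
      open Tree (state [] m B (positive⇒ranked positive))
      module L x = Limit (Branch.path-next x) (Branch.path-len x)

-- Reducing E₁ to the restriction of F to an analytic set

module _ (em : ExcludedMiddle 0ℓ) {V : Subset 𝓔∞-space} (V-analytic : Analytic 𝓔∞-space V) where

  open Classical em
  open Ramsey em V-analytic

  -- The minima of B form a positive set: given Z almost inside it, merge classes of B until the
  -- minima from m on lie in Z, and take a point of V in the resulting cube. Two fusions then make
  -- every stem settled and classified.
  E₁-reduces-to-positive : ∀ B m → (∀ B′ → B′ ∈ [ m , B ]∞ → ∃[ A ] (A ∈ [ m , B′ ]∞ × A ∈ V)) →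
                           BorelReducible 2^ℕ×ℕ E₁ (subspace 𝓔∞-space V) (F ↾ V)
  E₁-reduces-to-positive B m meets =
    let Y₁ , Y₁⊆Y₀ , settled    = fusion-on-stems settled-mono settled-resp settled-dense Y₀
        Y₂ , Y₂⊆Y₁ , classified = fusion-on-stems classified-mono classified-resp classified-dense Y₁
    in Decided.reduction-from-positive (λ u l A → settled-mono Y₂⊆Y₁ (settled u l A)) classified
         (positive-mono (⊆*-trans Y₂⊆Y₁ Y₁⊆Y₀) positive)
    where
    Y₀ : InfiniteSet
    Y₀ = collect (Lead B) (Representatives.leads-unbounded B em)

    positive : Positive Y₀ [] m B
    positive Z (almost N Z⊆Y₀) =
      let A , (A≤B′ , AB′) , A∈V = meets merged merged∈cube
          v , v-approx = complete {A} A∈V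
      in A , ≈-trans {A = B} {merged} {A} (≈-sym (near (proj₂ merged∈cube))) (≈-sym (near AB′)) ,
         through v (λ _ ()) v-approx ,
         λ l≤j lead → merged-leads l≤j (lead-coarse {A} {merged} A≤B′ lead)
      where
      open Analytic V-analytic using (complete)

      cofinal : ∀ n → ∃[ q ] (n ≤ℕ q × (Lead B q × Z ∋ q))
      cofinal n = let q , le , z = unbounded Z (n ⊔ N) in
        q , ≤-trans (m≤m⊔n n N) le , toWitness (Z⊆Y₀ q (≤-trans (m≤n⊔m n N) le) z) , z

      open Merge B m Z cofinal

-- Complexity of F and the spectrum

E₁-isEquivalence : IsEquivalence E₁
E₁-isEquivalence = record
  { refl  = 0 , λ _ _ → refl
  ; sym   = λ (n₀ , p) → n₀ , λ n m → sym (p n m)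
  ; trans = λ {x} {y} {z} (n₀ , p) (n₁ , q) → n₀ + n₁ , λ n m → trans
      (subst (λ i → x i m ≡ y i m) (sym (+-assoc n₀ n₁ n)) (p (n₁ + n) m))
      (subst (λ i → y i m ≡ z i m) (trans (sym (+-assoc n₁ n₀ n)) (cong (_+ n) (+-comm n₁ n₀))) (q (n₀ + n) m))
  }

-- A countable union of closed sets: a difference in some row from n₀ on is an open condition.
E₁-borel : BorelRel 2^ℕ×ℕ E₁
E₁-borel = union λ n₀ → resp
  ((λ {(x , y)} none n m → decidable-stable (x (n₀ + n) m ≟ᵇ y (n₀ + n) m) λ x≢y → none (n , m , x≢y)) ,
   (λ same (n , m , x≢y) → x≢y (same n m)))
  (complement (open-set {U = λ (x , y) → ∃[ n ] ∃[ m ] ¬ (x (n₀ + n) m ≡ y (n₀ + n) m)}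
    λ _ (n , m , x≢y) → suc ((n₀ + n) ⊔ m) , λ _ (xx′ , yy′) →
      let i< = s≤s (m≤m⊔n (n₀ + n) m) ; j< = s≤s (m≤n⊔m (n₀ + n) m)
      in n , m , λ x′≡y′ → x≢y (trans (xx′ _ _ i< j<) (trans x′≡y′ (sym (yy′ _ _ i< j<))))))

F-isEquivalence : IsEquivalence F
F-isEquivalence = On.isEquivalence code E₁-isEquivalence

F-borel : BorelRel 𝓔∞-space F
F-borel = borel-preimage {f = map× code code}
  (λ k → k , λ (p , q) → proj₂ (code-continuous k) p , proj₂ (code-continuous k) q) E₁-borel

-- F is the projection of the cylinder over itself; any matrix serves as the witness.
F-analytic : AnalyticRel 𝓔∞-space F
F-analytic = (λ (p , _) → uncurry F p) , borel-preimage {f = proj₁} (λ k → k , proj₁) F-borel ,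
  λ x y → mk⇔ (λ xy → (λ _ _ → true) , xy) proj₂

F≤E₁ : BorelReducible 𝓔∞-space F 2^ℕ×ℕ E₁
F≤E₁ = code , borel-preimage code-continuous , λ _ _ → mk⇔ id id

restriction-reducible : ∀ {X} R (C : Subset X) → BorelReducible (subspace X C) (R ↾ C) X R
restriction-reducible _ C = proj₁ , borel-preimage (λ k → k , id) , λ _ _ → mk⇔ id id

discrete : 𝓔∞
discrete = record
  { matrix        = _≡ᵇ_
  ; isEquivalence = record
    { refl  = λ {i} → ≡⇒≡ᵇ i i refl
    ; sym   = λ {i} {j} t → ≡⇒≡ᵇ j i (sym (≡ᵇ⇒≡ i j t))
    ; trans = λ {i} {j} {k} t t′ → ≡⇒≡ᵇ i k (trans (≡ᵇ⇒≡ i j t) (≡ᵇ⇒≡ j k t′))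
    }
  ; infinite      = id , λ {i} {j} → ≡ᵇ⇒≡ i j
  }

module _ (em : ExcludedMiddle 0ℓ) where

  E₁≤F↾cube : ∀ m B → BorelReducible 2^ℕ×ℕ E₁ (subspace 𝓔∞-space [ m , B ]∞) (F ↾ [ m , B ]∞)
  E₁≤F↾cube m B = E₁-reduces-to-positive em (cube-closed m B) B m
    -- Each B′ in the cube is itself a member of V in its own cube.
    λ B′ B′∈ → B′ , (coarsening {B′} {B′} id , λ _ _ _ _ → refl) , B′∈

  -- The set 𝓒 can be 𝓑 itself: failure to lie in the ideal, negated classically, gives a cube all
  -- of whose subcubes with the same m meet 𝓑.
  F-inSpectrum : InSpectrum 𝓔∞-space 𝓘⟨𝓔∞⟩ F
  F-inSpectrum = F-isEquivalence , F-analytic , λ 𝓑 𝓑-borel 𝓑∉𝓘 →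
    let B , m , meets = positive-cube 𝓑∉𝓘
        E₁≤F↾𝓑 = E₁-reduces-to-positive em (proj₁ (borel⇒bianalytic em 𝓑-borel)) B m meets
    in 𝓑 , 𝓑-borel , id , 𝓑∉𝓘 ,
       reducible-trans F E₁ (F ↾ 𝓑) F≤E₁ E₁≤F↾𝓑 , restriction-reducible F 𝓑
    where
    positive-cube : ∀ {𝓑} → ¬ (𝓑 ∈ 𝓘⟨𝓔∞⟩) →
                    ∃[ B ] ∃[ m ] (∀ B′ → B′ ∈ [ m , B ]∞ → ∃[ A ] (A ∈ [ m , B′ ]∞ × A ∈ 𝓑))
    positive-cube 𝓑∉𝓘 = decidable-stable em λ none → 𝓑∉𝓘 λ B m → decidable-stable em λ no-B′ →
      none (B , m , λ B′ B′∈ → decidable-stable em λ no-A → no-B′ (B′ , B′∈ , λ A A∈ → no-A (A , A∈)))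

proposition1p1 : ExcludedMiddle 0ℓ →
    Σ[ F ∈ Rel 𝓔∞ 0ℓ ]
    ( IsEquivalence F
    × BorelRel 𝓔∞-space F
    × BorelBireducible 𝓔∞-space F 2^ℕ×ℕ E₁
    × InSpectrum 𝓔∞-space 𝓘⟨𝓔∞⟩ F
    × (∀ (m : ℕ) (B : 𝓔∞) →
    BorelBireducible (subspace 𝓔∞-space [ m , B ]∞) (F ↾ [ m , B ]∞) 2^ℕ×ℕ E₁) )
proposition1p1 em = F , F-isEquivalence , F-borel ,
  -- E₁ reaches F through the restriction of F to one particular cube.
  (F≤E₁ , reducible-trans E₁ (F ↾ [ 0 , discrete ]∞) F
            (E₁≤F↾cube em 0 discrete) (restriction-reducible F [ 0 , discrete ]∞)) ,
  F-inSpectrum em ,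
  λ m B → reducible-trans (F ↾ [ m , B ]∞) F E₁ (restriction-reducible F [ m , B ]∞) F≤E₁ , E₁≤F↾cube em m B
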